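{- The following two statements are equivalent: (1) every cubic, bipartite, 2-factor Hamiltonian graph can be constructed from copies of $K_{3,3}$ and the Heawood graph by repeated application of the star product; (2) the Heawood graph and $K_{3,3}$ are the only 2-factor Hamiltonian, cubic braces.
   Context: Graphs are finite and simple. A \emph{2-factor} is a $2$-regular spanning subgraph; a graph is \emph{2-factor Hamiltonian} if every 2-factor is a Hamiltonian cycle. The \emph{star product} $(G_1,v_1)*(G_2,v_2)$ of graphs $G_1,G_2$ at vertices $v_1,v_2$ of degree $3$ is obtained by deleting $v_1$ and $v_2$ from the disjoint union and joining the three neighbours of $v_1$ to the three neighbours of $v_2$ via a matching of size $3$. A graph is \emph{matching covered} if it is connected and every edge lies in a perfect matching; a cut $\partial(X)$ (edges with exactly one end in $X$) is \emph{tight} if it meets every perfect matching in exactly one edge, and \emph{trivial} if $|X|=1$ or $|V(G)\setminus X|=1$. A \emph{brace} is a bipartite matching covered graph with no non-trivial tight cut. The \emph{Heawood graph} is the bipartite incidence graph of the points and lines of the Fano plane (cubic, $14$ vertices). -}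

module Defs where

open import Data.Nat using (ℕ; zero; suc; _+_; _≤_; _∸_; _%_; _<ᵇ_; _≡ᵇ_)
open import Data.Fin using (Fin; zero; suc; toℕ; splitAt; punchIn)
open import Data.Bool using (Bool; true; false; if_then_else_; _∧_; _∨_; not)
open import Data.Sum using (_⊎_; inj₁; inj₂)
open import Data.Product using (Σ; ∃; ∃-syntax; _×_; _,_)
open import Relation.Binary.PropositionalEquality using (_≡_; _≢_)
open import Relation.Nullary using (¬_)
open import Function using (_∘_; _⤖_)
open import Function.Bundles using (Bijection)
open import Function.Definitions using (Injective)

Graph : ℕ → Set
Graph n = Fin n → Fin n → Bool

IsSimple : ∀ {n} → Graph n → Set
IsSimple {n} G = (∀ (u v : Fin n) → G u v ≡ G v u) × (∀ (u : Fin n) → G u u ≡ false)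

count : ∀ {n} → (Fin n → Bool) → ℕ
count {zero}  f = 0
count {suc n} f = (if f zero then 1 else 0) + count (f ∘ suc)

deg : ∀ {n} → Graph n → Fin n → ℕ
deg G v = count (G v)

Cubic : ∀ {n} → Graph n → Set
Cubic {n} G = ∀ (v : Fin n) → deg G v ≡ 3

Bipartite : ∀ {n} → Graph n → Set
Bipartite {n} G = Σ (Fin n → Bool) λ c → ∀ (u v : Fin n) → G u v ≡ true → c u ≢ c v

_≅_ : ∀ {n m} → Graph n → Graph m → Set
_≅_ {n} {m} G H = Σ (Fin n ⤖ Fin m) λ f →
  ∀ (u v : Fin n) → G u v ≡ H (Bijection.to f u) (Bijection.to f v)

SpanningSub : ∀ {n} → Graph n → Graph n → Set
SpanningSub {n} G F = (∀ (u v : Fin n) → F u v ≡ F v u) × (∀ (u v : Fin n) → F u v ≡ true → G u v ≡ true)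

TwoFactor : ∀ {n} → Graph n → Graph n → Set
TwoFactor {n} G F = SpanningSub G F × (∀ (v : Fin n) → deg F v ≡ 2)

CycNext : ∀ {n} → Fin n → Fin n → Set
CycNext {n} i j = (toℕ j ≡ suc (toℕ i)) ⊎ ((suc (toℕ i) ≡ n) × (toℕ j ≡ 0))

HamiltonianCycle : ∀ {n} → Graph n → Set
HamiltonianCycle {n} F = (3 ≤ n) × Σ (Fin n → Fin n) λ σ → Injective _≡_ _≡_ σ ×
  (∀ (u v : Fin n) →
     (F u v ≡ true → ∃[ i ] ∃[ j ] (σ i ≡ u × σ j ≡ v × (CycNext i j ⊎ CycNext j i))) ×
     ((∃[ i ] ∃[ j ] (σ i ≡ u × σ j ≡ v × (CycNext i j ⊎ CycNext j i))) → F u v ≡ true))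

TwoFactorHamiltonian : ∀ {n} → Graph n → Set
TwoFactorHamiltonian {n} G = ∀ (F : Graph n) → TwoFactor G F → HamiltonianCycle F

PerfectMatching : ∀ {n} → Graph n → Graph n → Set
PerfectMatching {n} G P = SpanningSub G P × (∀ (v : Fin n) → deg P v ≡ 1)

data Reach {n} (G : Graph n) : Fin n → Fin n → Set where
  here : ∀ {u} → Reach G u u
  step : ∀ {u v w} → G u v ≡ true → Reach G v w → Reach G u w

Connected : ∀ {n} → Graph n → Set
Connected {n} G = ∀ (u v : Fin n) → Reach G u v

MatchingCovered : ∀ {n} → Graph n → Set
MatchingCovered {n} G = Connected G ×
  (∀ (u v : Fin n) → G u v ≡ true → Σ (Graph n) λ P → PerfectMatching G P × P u v ≡ true)

sumFin : ∀ {n} → (Fin n → ℕ) → ℕ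
sumFin {zero}  f = 0
sumFin {suc n} f = f zero + sumFin (f ∘ suc)

-- number of edges of P in the cut ∂(X) (each edge counted once, as the
-- ordered pair (u,v) with u ∈ X, v ∉ X)
cutCount : ∀ {n} → (Fin n → Bool) → Graph n → ℕ
cutCount X P = sumFin λ u → if X u then count (λ v → not (X v) ∧ P u v) else 0

TightCut : ∀ {n} → Graph n → (Fin n → Bool) → Set
TightCut {n} G X = ∀ (P : Graph n) → PerfectMatching G P → cutCount X P ≡ 1

TrivialCut : ∀ {n} → (Fin n → Bool) → Set
TrivialCut X = (count X ≡ 1) ⊎ (count (not ∘ X) ≡ 1)

Brace : ∀ {n} → Graph n → Set
Brace {n} G = Bipartite G × MatchingCovered G ×
  (∀ (X : Fin n → Bool) → TightCut G X → TrivialCut X)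

K33 : Graph 6
K33 x y = (toℕ x <ᵇ 3) ∧ not (toℕ y <ᵇ 3) ∨ not (toℕ x <ᵇ 3) ∧ (toℕ y <ᵇ 3)

-- Fano plane: points 0..6, lines L_l = {l, l+1, l+3} (mod 7), l = 0..6
incident : ℕ → ℕ → Bool
incident p l = (p ≡ᵇ (l % 7)) ∨ (p ≡ᵇ ((l + 1) % 7)) ∨ (p ≡ᵇ ((l + 3) % 7))

-- Heawood graph: vertices 0..6 are points, 7..13 are lines (7 + l ↦ L_l)
Heawood : Graph 14
Heawood x y =
  ((toℕ x <ᵇ 7) ∧ not (toℕ y <ᵇ 7) ∧ incident (toℕ x) (toℕ y ∸ 7)) ∨
  (not (toℕ x <ᵇ 7) ∧ (toℕ y <ᵇ 7) ∧ incident (toℕ y) (toℕ x ∸ 7))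

-- Star product.
-- G₁ has vertices Fin (suc m₁), G₂ has vertices Fin (suc m₂).  The
-- vertices of G₁ - v₁ are punchIn v₁ a (a : Fin m₁), those of G₂ - v₂ are
-- punchIn v₂ b (b : Fin m₂); the product has vertex set Fin (m₁ + m₂),
-- split by splitAt m₁.  M a b says the neighbour punchIn v₁ a of v₁ is
-- joined to the neighbour punchIn v₂ b of v₂.

crossAdj : ∀ {m₁ m₂} → Graph (suc m₁) → Fin (suc m₁) → Graph (suc m₂) → Fin (suc m₂) →
           (Fin m₁ → Fin m₂ → Bool) → Fin m₁ ⊎ Fin m₂ → Fin m₁ ⊎ Fin m₂ → Bool
crossAdj G₁ v₁ G₂ v₂ M (inj₁ a) (inj₁ b) = G₁ (punchIn v₁ a) (punchIn v₁ b)
crossAdj G₁ v₁ G₂ v₂ M (inj₂ a) (inj₂ b) = G₂ (punchIn v₂ a) (punchIn v₂ b)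
crossAdj G₁ v₁ G₂ v₂ M (inj₁ a) (inj₂ b) = M a b
crossAdj G₁ v₁ G₂ v₂ M (inj₂ b) (inj₁ a) = M a b

starProduct : ∀ {m₁ m₂} → Graph (suc m₁) → Fin (suc m₁) → Graph (suc m₂) → Fin (suc m₂) →
              (Fin m₁ → Fin m₂ → Bool) → Graph (m₁ + m₂)
starProduct {m₁} G₁ v₁ G₂ v₂ M x y = crossAdj G₁ v₁ G₂ v₂ M (splitAt m₁ x) (splitAt m₁ y)

StarMatching : ∀ {m₁ m₂} → Graph (suc m₁) → Fin (suc m₁) → Graph (suc m₂) → Fin (suc m₂) →
               (Fin m₁ → Fin m₂ → Bool) → Set
StarMatching {m₁} {m₂} G₁ v₁ G₂ v₂ M =
  (∀ (a : Fin m₁) (b : Fin m₂) → M a b ≡ true →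
     (G₁ v₁ (punchIn v₁ a) ≡ true) × (G₂ v₂ (punchIn v₂ b) ≡ true)) ×
  (∀ (a : Fin m₁) → G₁ v₁ (punchIn v₁ a) ≡ true → count (M a) ≡ 1) ×
  (∀ (b : Fin m₂) → G₂ v₂ (punchIn v₂ b) ≡ true → count (λ a → M a b) ≡ 1)

data Constructible : (n : ℕ) → Graph n → Set where
  k33     : Constructible 6 K33
  heawood : Constructible 14 Heawood
  star    : ∀ {m₁ m₂} {G₁ : Graph (suc m₁)} {G₂ : Graph (suc m₂)}
              (v₁ : Fin (suc m₁)) (v₂ : Fin (suc m₂)) (M : Fin m₁ → Fin m₂ → Bool) →
              Constructible (suc m₁) G₁ → Constructible (suc m₂) G₂ →
              deg G₁ v₁ ≡ 3 → deg G₂ v₂ ≡ 3 → StarMatching G₁ v₁ G₂ v₂ M →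
              Constructible (m₁ + m₂) (starProduct G₁ v₁ G₂ v₂ M)

Statement1 : Set
Statement1 = ∀ (n : ℕ) (G : Graph n) → IsSimple G → Cubic G → Bipartite G →
  TwoFactorHamiltonian G → Σ (Graph n) λ H → Constructible n H × (G ≅ H)

Statement2 : Set
Statement2 = ∀ (n : ℕ) (G : Graph n) → IsSimple G → Cubic G → Brace G →
  TwoFactorHamiltonian G → (G ≅ K33) ⊎ (G ≅ Heawood)

{-# OPTIONS --safe #-}
module Submission where

-- Both directions rest on the fact that the tight cuts of a cubic bipartite
-- graph G are its 3-edge cuts.  G is a union of three perfect matchings, so a
-- tight cut has three edges.  Conversely, counting edges by colour inside one
-- shore shows that the three edges of a 3-cut leave it from the same colour
-- class, so that class exceeds the other by one vertex and each perfect
-- matching uses exactly one edge of the cut.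
--
-- (1) ⇒ (2): the edges joining the two factors of a star product form a
-- nontrivial 3-cut, so a constructible brace is K₃,₃ or the Heawood graph.
--
-- (2) ⇒ (1): by induction on the order.  Without a nontrivial 3-cut, G is a
-- brace.  Otherwise 2-factor Hamiltonicity excludes cuts with fewer than three
-- edges, so the cut is a matching and G is the star product of its two
-- contractions.  These are again cubic and bipartite, and every 2-factor of
-- one extends to a 2-factor of G by one of the other, whence it is connected.

open import Defs
open import Algebra.Properties.CommutativeMonoid.Sum using ()
open import Data.Bool using (Bool; true; false; if_then_else_; _∧_; _∨_; not)
open import Data.Bool.Properties as Bool using ()
open import Data.Fin using (Fin; zero; suc; toℕ; fromℕ<; inject₁; splitAt; punchIn; punchOut; _≟_; _↑ˡ_; _↑ʳ_)
open import Data.Fin.Induction using (<-weakInduction)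
open import Data.Fin.Permutation as Perm using (Permutation; _⟨$⟩ʳ_; _⟨$⟩ˡ_)
open import Data.Fin.Properties using (any?; all?; punchOut-injective; injective⇒≤; toℕ-injective; toℕ<n; toℕ-fromℕ<; toℕ-inject₁; +↔⊎; splitAt-↑ˡ; splitAt-↑ʳ; splitAt-join)
open import Data.Fin.Subset.Properties using (anySubset?)
open import Data.Nat as ℕ using (ℕ; zero; suc; _+_; _*_; _∸_; _≤_; _<_; z≤n; s≤s; _≤?_; _<?_)
open import Data.Nat.Divisibility using (_∣_; m∣m*n; ∣m+n∣m⇒∣n; ∣1⇒≡1)
open import Data.Nat.Induction using (<-wellFounded)
open import Data.Nat.Properties hiding (_≟_; _≤?_; _<?_)
open import Data.Product using (Σ; ∃-syntax; _×_; _,_; proj₁; proj₂)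
open import Data.Sum as Sum using (_⊎_; inj₁; inj₂)
open import Data.Sum.Function.Propositional using (_⊎-↔_)
open import Data.Sum.Properties using (swap-involutive)
open import Data.Vec using (lookup; tabulate)
open import Data.Vec.Properties using (lookup∘tabulate)
open import Function using (_∘_; _↔_; mk↔ₛ′; mk⇔; Inverse; Bijection)
open import Function.Bundles using (_⇔_)
open import Function.Construct.Composition using (_↔-∘_)
open import Function.Construct.Symmetry using (↔-sym)
open import Function.Definitions using (Injective)
open import Function.Properties.Bijection using (⤖⇒↔)
open import Function.Properties.Inverse using (↔⇒⤖)
open import Induction.WellFounded using (Acc; acc)
open import Relation.Binary.Definitions using (tri<; tri≈; tri>)
open import Relation.Binary.PropositionalEquality
open import Relation.Nullary using (¬_; Dec; yes; no; does; contradiction; _×-dec_)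
open import Relation.Nullary.Decidable using (dec-true; dec-false; toWitness)

-- Sums, counts, and pairs of vertices

-- A Hamiltonian cycle is given as a cyclic enumeration of the vertices, and such an enumeration
-- does not pass well to a contraction. Connectedness does: the image of a connected graph under a
-- collapsing map is connected. The argument about cuts and contractions therefore works with "every
-- 2-factor is connected", which for bipartite graphs on at least three vertices amounts to 2-factor
-- Hamiltonicity; the enumeration is rebuilt only to state the induction hypothesis for the
-- contractions. All counting goes through one quantity, `pairs R S T`. The identity `balance`,
-- valid for every regular bipartite graph, is used twice over: with degree 3 for the graph itself,
-- where divisibility by 3 puts all three cut edges at one colour class, and with degree 1 for a
-- perfect matching, where it fixes how often the matching crosses the cut.

module ΣN = Algebra.Properties.CommutativeMonoid.Sum +-0-commutativeMonoid

bit : Bool → ℕ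
bit b = if b then 1 else 0

sumFin≡sum : ∀ {n} (f : Fin n → ℕ) → sumFin f ≡ ΣN.sum f
sumFin≡sum {zero}  f = refl
sumFin≡sum {suc n} f = cong (f zero +_) (sumFin≡sum (f ∘ suc))

count≡sum : ∀ {n} (f : Fin n → Bool) → count f ≡ sumFin (bit ∘ f)
count≡sum {zero}  f = refl
count≡sum {suc n} f = cong (bit (f zero) +_) (count≡sum (f ∘ suc))

sum-cong : ∀ {n} {f g : Fin n → ℕ} → (∀ i → f i ≡ g i) → sumFin f ≡ sumFin g
sum-cong {zero}  e = refl
sum-cong {suc n} e = cong₂ _+_ (e zero) (sum-cong (e ∘ suc))

sum-+ : ∀ {n} (f g : Fin n → ℕ) → sumFin (λ i → f i + g i) ≡ sumFin f + sumFin g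
sum-+ f g = trans (sumFin≡sum (λ i → f i + g i))
  (trans (ΣN.∑-distrib-+ f g) (sym (cong₂ _+_ (sumFin≡sum f) (sumFin≡sum g))))

sum-* : ∀ {n} k (f : Fin n → ℕ) → sumFin (λ i → k * f i) ≡ k * sumFin f
sum-* {zero}  k f = sym (*-zeroʳ k)
sum-* {suc n} k f = trans (cong (k * f zero +_) (sum-* k (f ∘ suc)))
                          (sym (*-distribˡ-+ k (f zero) (sumFin (f ∘ suc))))

sum-swap : ∀ {m n} (f : Fin m → Fin n → ℕ) →
           sumFin (λ i → sumFin (f i)) ≡ sumFin (λ j → sumFin (λ i → f i j))
sum-swap f = trans (nested f) (trans (ΣN.∑-comm f) (sym (nested (λ j i → f i j))))
  where
  nested : ∀ {m n} (f : Fin m → Fin n → ℕ) →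
           sumFin (λ i → sumFin (f i)) ≡ ΣN.sum (λ i → ΣN.sum (f i))
  nested f = trans (sum-cong (λ i → sumFin≡sum (f i))) (sumFin≡sum (λ i → ΣN.sum (f i)))

sum-mono : ∀ {n} {f g : Fin n → ℕ} → (∀ i → f i ≤ g i) → sumFin f ≤ sumFin g
sum-mono {zero}  e = z≤n
sum-mono {suc n} e = +-mono-≤ (e zero) (sum-mono (e ∘ suc))

sum-mono-< : ∀ {n} {f g : Fin n → ℕ} → (∀ i → f i ≤ g i) → ∀ k → f k < g k → sumFin f < sumFin g
sum-mono-< e zero    lt = +-mono-<-≤ lt (sum-mono (e ∘ suc))
sum-mono-< e (suc k) lt = +-mono-≤-< (e zero) (sum-mono-< (e ∘ suc) k lt)

sum-0 : ∀ {n} (f : Fin n → ℕ) → (∀ i → f i ≡ 0) → sumFin f ≡ 0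
sum-0 {zero}  f e = refl
sum-0 {suc n} f e = cong₂ _+_ (e zero) (sum-0 (f ∘ suc) (e ∘ suc))

sum-term : ∀ {n} (f : Fin n → ℕ) i → f i ≤ sumFin f
sum-term f zero    = m≤m+n _ _
sum-term f (suc i) = ≤-trans (sum-term (f ∘ suc) i) (m≤n+m _ _)

sum-permute : ∀ {m n} (f : Fin n → ℕ) (π : Permutation m n) →
              sumFin f ≡ sumFin (λ i → f (π ⟨$⟩ʳ i))
sum-permute f π = trans (sumFin≡sum f) (trans (ΣN.sum-permute f π)
                    (sym (sumFin≡sum (λ i → f (π ⟨$⟩ʳ i)))))

sum-punchIn : ∀ {n} (f : Fin (suc n) → ℕ) i → sumFin f ≡ f i + sumFin (f ∘ punchIn i)
sum-punchIn f i = trans (sumFin≡sum f) (trans (ΣN.sum-remove {i = i} f)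
                    (cong (f i +_) (sym (sumFin≡sum (f ∘ punchIn i)))))

sum-join : ∀ m {n} (f : Fin (m + n) → ℕ) →
           sumFin f ≡ sumFin (λ a → f (a ↑ˡ n)) + sumFin (λ b → f (m ↑ʳ b))
sum-join zero    f = refl
sum-join (suc m) f = trans (cong (f zero +_) (sum-join m (f ∘ suc))) (sym (+-assoc (f zero) _ _))

sum-1 : ∀ n → sumFin {n} (λ _ → 1) ≡ n
sum-1 zero    = refl
sum-1 (suc n) = cong suc (sum-1 n)

bit≤1 : ∀ b → bit b ≤ 1
bit≤1 true  = ≤-refl
bit≤1 false = z≤n

bit-mono : ∀ {a b} → (a ≡ true → b ≡ true) → bit a ≤ bit b
bit-mono {false}     h = z≤n
bit-mono {true}  {b} h rewrite h refl = ≤-refl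

bit-difference : ∀ {g p} → (p ≡ true → g ≡ true) → bit g ≡ bit (g ∧ not p) + bit p
bit-difference {g}     {true}  h rewrite h refl = refl
bit-difference {true}  {false} h = refl
bit-difference {false} {false} h = refl

⇔⇒≡ : ∀ {a b} → (a ≡ true → b ≡ true) → (b ≡ true → a ≡ true) → a ≡ b
⇔⇒≡ {true}          h k = sym (h refl)
⇔⇒≡ {false} {true}  h k = k refl
⇔⇒≡ {false} {false} h k = refl

∧-true : ∀ {a b} → a ∧ b ≡ true → a ≡ true × b ≡ true
∧-true {true} {true} _ = refl , refl

∧-intro : ∀ {a b} → a ≡ true → b ≡ true → a ∧ b ≡ true
∧-intro refl refl = refl

∨-true : ∀ {a b} → a ∨ b ≡ true → a ≡ true ⊎ b ≡ true
∨-true {true}         _ = inj₁ refl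
∨-true {false} {true} _ = inj₂ refl

true≢false : ∀ {b} → b ≡ true → b ≢ false
true≢false refl ()

true⇒not≢true : ∀ {b} → b ≡ true → not b ≢ true
true⇒not≢true refl ()

does-true : ∀ {A : Set} (a? : Dec A) → does a? ≡ true → A
does-true (yes a) _ = a

count-cong : ∀ {n} {f g : Fin n → Bool} → (∀ i → f i ≡ g i) → count f ≡ count g
count-cong {f = f} {g} e =
  trans (count≡sum f) (trans (sum-cong (λ i → cong bit (e i))) (sym (count≡sum g)))

count-mono : ∀ {n} {f g : Fin n → Bool} → (∀ i → f i ≡ true → g i ≡ true) → count f ≤ count g
count-mono {f = f} {g} e =
  subst₂ _≤_ (sym (count≡sum f)) (sym (count≡sum g)) (sum-mono (λ i → bit-mono (e i)))

count-+ : ∀ {n} {f g h : Fin n → Bool} → (∀ i → bit (h i) ≡ bit (f i) + bit (g i)) →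
          count h ≡ count f + count g
count-+ {f = f} {g} {h} e = trans (count≡sum h) (trans (sum-cong e)
  (trans (sum-+ (bit ∘ f) (bit ∘ g)) (sym (cong₂ _+_ (count≡sum f) (count≡sum g)))))

count≤n : ∀ {n} (f : Fin n → Bool) → count f ≤ n
count≤n {zero}  f = z≤n
count≤n {suc n} f = +-mono-≤ (bit≤1 (f zero)) (count≤n (f ∘ suc))

count-permute : ∀ {m n} (f : Fin n → Bool) (π : Permutation m n) →
                count f ≡ count (λ i → f (π ⟨$⟩ʳ i))
count-permute f π = trans (count≡sum f) (trans (sum-permute (bit ∘ f) π) (sym (count≡sum (λ i → f (π ⟨$⟩ʳ i)))))

count-none : ∀ {n} (f : Fin n → Bool) → (∀ i → f i ≡ false) → count f ≡ 0
count-none f e = trans (count≡sum f) (sum-0 (bit ∘ f) (λ i → cong bit (e i)))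

count-pos : ∀ {n} (f : Fin n → Bool) {a} → f a ≡ true → 1 ≤ count f
count-pos f {a} fa = subst₂ _≤_ (cong bit fa) (sym (count≡sum f)) (sum-term (bit ∘ f) a)

count-pos⁻¹ : ∀ {n} (f : Fin n → Bool) → 1 ≤ count f → ∃[ a ] f a ≡ true
count-pos⁻¹ {suc n} f p with f zero in eq
... | true  = zero , eq
... | false with a , fa ← count-pos⁻¹ (f ∘ suc) p = suc a , fa

count-two : ∀ {n} (f : Fin n → Bool) {a b} → a ≢ b → f a ≡ true → f b ≡ true → 2 ≤ count f
count-two f {zero}  {zero}  ne fa fb = contradiction refl ne
count-two f {zero}  {suc b} ne fa fb rewrite fa = s≤s (count-pos (f ∘ suc) fb)
count-two f {suc a} {zero}  ne fa fb rewrite fb = s≤s (count-pos (f ∘ suc) fa)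
count-two f {suc a} {suc b} ne fa fb =
  ≤-trans (count-two (f ∘ suc) (ne ∘ cong suc) fa fb) (m≤n+m _ _)

count-two⁻¹ : ∀ {n} (f : Fin n → Bool) → 2 ≤ count f →
              ∃[ a ] ∃[ b ] (a ≢ b × f a ≡ true × f b ≡ true)
count-two⁻¹ {suc n} f p with f zero in eq
... | true  with b , fb ← count-pos⁻¹ (f ∘ suc) (≤-pred p) = zero , suc b , (λ ()) , eq , fb
... | false with a , b , ne , fa , fb ← count-two⁻¹ (f ∘ suc) p =
  suc a , suc b , (λ { refl → ne refl }) , fa , fb

count≤1⇒unique : ∀ {n} (f : Fin n → Bool) → count f ≤ 1 →
                 ∀ {a b} → f a ≡ true → f b ≡ true → a ≡ b
count≤1⇒unique f p {a} {b} fa fb with a ≟ b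
... | yes e = e
... | no ne = contradiction (≤-trans (count-two f ne fa fb) p) λ { (s≤s ()) }

unique⇒count≤1 : ∀ {n} (f : Fin n → Bool) → (∀ {a b} → f a ≡ true → f b ≡ true → a ≡ b) → count f ≤ 1
unique⇒count≤1 f u with count f ≤? 1
... | yes p = p
... | no ¬p with a , b , ne , fa , fb ← count-two⁻¹ f (≰⇒> ¬p) = contradiction (u fa fb) ne

count-single : ∀ {n} (f : Fin n → Bool) {a} → f a ≡ true → (∀ b → f b ≡ true → b ≡ a) → count f ≡ 1
count-single f fa u = ≤-antisym (unique⇒count≤1 f (λ x y → trans (u _ x) (sym (u _ y)))) (count-pos f fa)

count-single⁻¹ : ∀ {n} (f : Fin n → Bool) → count f ≡ 1 →
                 ∃[ a ] (f a ≡ true × (∀ b → f b ≡ true → b ≡ a))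
count-single⁻¹ f e with a , fa ← count-pos⁻¹ f (≤-reflexive (sym e)) =
  a , fa , λ b fb → count≤1⇒unique f (≤-reflexive e) fb fa

-- These are ordered pairs, so double counting is an exchange of summation. Taking `all` for `T`
-- gives a degree sum, taking the complement of `S` gives the size of a cut.
pairs : ∀ {m n} → (Fin m → Fin n → Bool) → (Fin m → Bool) → (Fin n → Bool) → ℕ
pairs R S T = sumFin λ u → sumFin λ v → bit (S u ∧ T v ∧ R u v)

all : ∀ {n} → Fin n → Bool
all _ = true

module _ {m n : ℕ} (R : Fin m → Fin n → Bool) where

  pairs-mono : ∀ S S′ T T′ → (∀ u v → S u ≡ true → T v ≡ true → R u v ≡ true → S′ u ≡ true × T′ v ≡ true) →
               pairs R S T ≤ pairs R S′ T′
  pairs-mono S S′ T T′ h = sum-mono λ u → sum-mono λ v → bit-mono λ e →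
    let s , tr = ∧-true {S u} e ; t , r = ∧-true tr ; s′ , t′ = h u v s t r in ∧-intro s′ (∧-intro t′ r)

  pairs-splitˡ : ∀ S S₁ S₂ T → (∀ u → bit (S u) ≡ bit (S₁ u) + bit (S₂ u)) →
                 pairs R S T ≡ pairs R S₁ T + pairs R S₂ T
  pairs-splitˡ S S₁ S₂ T h =
    trans (sum-cong λ u → trans (sum-cong λ v → aux {S u} {S₁ u} {S₂ u} (T v ∧ R u v) (h u))
            (sum-+ (λ v → bit (S₁ u ∧ T v ∧ R u v)) (λ v → bit (S₂ u ∧ T v ∧ R u v))))
          (sum-+ (λ u → sumFin λ v → bit (S₁ u ∧ T v ∧ R u v)) (λ u → sumFin λ v → bit (S₂ u ∧ T v ∧ R u v)))
    where
    aux : ∀ {a b c} d → bit a ≡ bit b + bit c → bit (a ∧ d) ≡ bit (b ∧ d) + bit (c ∧ d)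
    aux {a} {b} {c} true e rewrite Bool.∧-identityʳ a | Bool.∧-identityʳ b | Bool.∧-identityʳ c = e
    aux {a} {b} {c} false e rewrite Bool.∧-zeroʳ a | Bool.∧-zeroʳ b | Bool.∧-zeroʳ c = refl

  pairs-transpose : ∀ S T → pairs R S T ≡ pairs (λ v u → R u v) T S
  pairs-transpose S T = trans (sum-swap (λ u v → bit (S u ∧ T v ∧ R u v)))
    (sum-cong λ v → sum-cong λ u → cong bit (aux (S u) (T v) (R u v)))
    where
    aux : ∀ a b c → a ∧ b ∧ c ≡ b ∧ a ∧ c
    aux true  b c = refl
    aux false b c = sym (Bool.∧-zeroʳ b)

  pairs-rows : ∀ S T → pairs R S T ≡ sumFin (λ u → bit (S u) * count (λ v → T v ∧ R u v))
  pairs-rows S T = sum-cong λ u → aux (S u) (λ v → T v ∧ R u v)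
    where
    aux : ∀ a (f : Fin n → Bool) → sumFin (λ v → bit (a ∧ f v)) ≡ bit a * count f
    aux true  f = trans (sym (count≡sum f)) (sym (+-identityʳ _))
    aux false f = sum-0 {n} (λ _ → 0) (λ _ → refl)

  pairs-regular : ∀ {r} S → (∀ u → count (R u) ≡ r) → pairs R S all ≡ r * count S
  pairs-regular {r} S d = trans (pairs-rows S all)
    (trans (sum-cong λ u → trans (cong (bit (S u) *_) (d u)) (*-comm (bit (S u)) r))
    (trans (sum-* r (bit ∘ S)) (cong (r *_) (sym (count≡sum S)))))

  pairs-none : ∀ {S T} → (∀ u v → S u ≡ true → T v ≡ true → R u v ≡ false) → pairs R S T ≡ 0
  pairs-none {S} {T} h = sum-0 _ λ u → sum-0 _ λ v → aux (S u) (T v) (h u v)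
    where
    aux : ∀ a b {c} → (a ≡ true → b ≡ true → c ≡ false) → bit (a ∧ b ∧ c) ≡ 0
    aux false b     h = refl
    aux true  false h = refl
    aux true  true  h = cong bit (h refl refl)

  pairs-term : ∀ {S T u v} → S u ≡ true → T v ≡ true → R u v ≡ true → 1 ≤ pairs R S T
  pairs-term {S} {T} {u} {v} s t r = ≤-trans (≤-trans
    (≤-reflexive (sym (cong bit (∧-intro s (∧-intro t r)))))
    (sum-term (λ v → bit (S u ∧ T v ∧ R u v)) v))
    (sum-term (λ u → sumFin λ v → bit (S u ∧ T v ∧ R u v)) u)

pairs-+ : ∀ {m n} {R R₁ R₂ : Fin m → Fin n → Bool} {S T} →
          (∀ u v → bit (R u v) ≡ bit (R₁ u v) + bit (R₂ u v)) →
          pairs R S T ≡ pairs R₁ S T + pairs R₂ S T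
pairs-+ {R = R} {R₁} {R₂} {S} {T} h =
  trans (sum-cong λ u → trans (sum-cong λ v → aux (S u) (T v) (h u v))
          (sum-+ (λ v → bit (S u ∧ T v ∧ R₁ u v)) (λ v → bit (S u ∧ T v ∧ R₂ u v))))
        (sum-+ (λ u → sumFin λ v → bit (S u ∧ T v ∧ R₁ u v)) (λ u → sumFin λ v → bit (S u ∧ T v ∧ R₂ u v)))
  where
  aux : ∀ s t {a b c} → bit a ≡ bit b + bit c → bit (s ∧ t ∧ a) ≡ bit (s ∧ t ∧ b) + bit (s ∧ t ∧ c)
  aux false t     e = refl
  aux true  false e = refl
  aux true  true  e = e

-- Perfect matchings in regular bipartite graphs

-- If `v` were missed, punching it out would inject `Fin (suc n)` into `Fin n`.
injective⇒surjective : ∀ {n} (f : Fin n → Fin n) → Injective _≡_ _≡_ f → ∀ v → ∃[ u ] f u ≡ v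
injective⇒surjective {suc n} f inj v with any? (λ u → f u ≟ v)
... | yes p = p
... | no ¬p = contradiction
  (injective⇒≤ {f = λ u → punchOut {i = v} {f u} (λ e → ¬p (u , sym e))}
               (λ {u} {w} e → inj (punchOut-injective (λ e → ¬p (u , sym e)) (λ e → ¬p (w , sym e)) e)))
  1+n≰n

-- Here `R` is read as a relation from one copy of the vertex set to another, so Hall's condition
-- below is that of the bipartite double cover, whose two sides have equal size.
N : ∀ {n} → Graph n → (Fin n → Bool) → Fin n → Bool
N R S v = does (1 ≤? count (λ u → S u ∧ R u v))

N-intro : ∀ {n} (R : Graph n) S {u v} → S u ≡ true → R u v ≡ true → N R S v ≡ true
N-intro R S {u} {v} s r = dec-true (_ ≤? _) (count-pos (λ u → S u ∧ R u v) (∧-intro s r))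

N-elim : ∀ {n} (R : Graph n) S {v} → N R S v ≡ true → ∃[ u ] (S u ≡ true × R u v ≡ true)
N-elim R S {v} e with u , p ← count-pos⁻¹ (λ u → S u ∧ R u v) (does-true (_ ≤? _) e) = u , ∧-true p

Hall : ∀ {n} → Graph n → Set
Hall {n} R = ∀ (S : Fin n → Bool) → count S ≤ count (N R S)

N-cong : ∀ {n} (R : Graph n) {S S′} → (∀ u → S u ≡ S′ u) → ∀ v → N R S v ≡ N R S′ v
N-cong R e v = cong (λ k → does (1 ≤? k)) (count-cong λ u → cong (_∧ R u v) (e u))

-- Failure must come with an explicit deficient set, since `rado` computes with two of them; a
-- search through all subsets supplies it.
hall? : ∀ {n} (R : Graph n) → Hall R ⊎ (∃[ S ] count (N R S) < count S)
hall? R with anySubset? (λ p → count (N R (lookup p)) <? count (lookup p))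
... | yes (p , lt) = inj₂ (lookup p , lt)
... | no ¬p = inj₁ λ S → subst₂ _≤_ (count-cong (lookup∘tabulate S))
        (count-cong (N-cong R (lookup∘tabulate S))) (≮⇒≥ λ lt → ¬p (tabulate S , lt))

remove : ∀ {n} → Graph n → Fin n → Fin n → Graph n
remove R a b u v = R u v ∧ not (does (u ≟ a) ∧ does (v ≟ b))

module _ {n : ℕ} (R : Graph n) (a b : Fin n) where

  remove-⊆ : ∀ {u v} → remove R a b u v ≡ true → R u v ≡ true
  remove-⊆ e = proj₁ (∧-true e)

  remove-otherˡ : ∀ {u v} → u ≢ a → R u v ≡ true → remove R a b u v ≡ true
  remove-otherˡ {u} ne r rewrite dec-false (u ≟ a) ne = ∧-intro r refl

  remove-otherʳ : ∀ {u v} → v ≢ b → R u v ≡ true → remove R a b u v ≡ true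
  remove-otherʳ {u} {v} ne r rewrite dec-false (v ≟ b) ne | Bool.∧-zeroʳ (does (u ≟ a)) = ∧-intro r refl

  remove-fewer : R a b ≡ true → sumFin (λ u → count (remove R a b u)) < sumFin (λ u → count (R u))
  remove-fewer r = sum-mono-< (λ u → count-mono {f = remove R a b u} {R u} λ v → remove-⊆ {u} {v}) a
    (subst₂ _<_ (sym (count≡sum (remove R a b a))) (sym (count≡sum (R a)))
      (sum-mono-< (λ v → bit-mono (remove-⊆ {a} {v})) b lt))
    where
    lt : bit (remove R a b a b) < bit (R a b)
    lt rewrite r | dec-true (a ≟ a) refl | dec-true (b ≟ b) refl = ≤-refl

  -- A set without `a` loses no neighbour when an edge at `a` is removed, so it cannot become
  -- deficient.
  deficient⇒∋ : Hall R → ∀ S → count (N (remove R a b) S) < count S → S a ≡ true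
  deficient⇒∋ hall S lt with S a in eq
  ... | true  = refl
  ... | false = contradiction (≤-trans (hall S) (count-mono sub)) (<⇒≱ lt)
    where
    sub : ∀ v → N R S v ≡ true → N (remove R a b) S v ≡ true
    sub v p with u , s , r ← N-elim R S p =
      N-intro (remove R a b) S s (remove-otherˡ (λ { refl → true≢false s eq }) r)

-- Rado's argument: by submodularity of S ↦ |N(S)|, the edges a b₁ and a b₂
-- cannot both be indispensable for Hall's condition.
rado : ∀ {n} (R : Graph n) {a b₁ b₂} → b₁ ≢ b₂ → R a b₁ ≡ true → R a b₂ ≡ true → Hall R →
       Hall (remove R a b₁) ⊎ Hall (remove R a b₂)
rado {n} R {a} {b₁} {b₂} ne r₁ r₂ hall with hall? (remove R a b₁) | hall? (remove R a b₂)
... | inj₁ h | _ = inj₁ h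
... | inj₂ _ | inj₁ h = inj₂ h
... | inj₂ (S₁ , lt₁) | inj₂ (S₂ , lt₂) = contradiction bound 1+n≰n
  where
  N₁ N₂ U I D : Fin n → Bool
  N₁ = N (remove R a b₁) S₁
  N₂ = N (remove R a b₂) S₂
  U u = S₁ u ∨ S₂ u
  I u = S₁ u ∧ S₂ u
  -- Neighbours of `a` itself may be missing from `N₁` or `N₂`, so `a` leaves the intersection; this
  -- costs one element.
  D u = I u ∧ not (does (u ≟ a))

  ∋₁ = deficient⇒∋ R a b₁ hall S₁ lt₁
  ∋₂ = deficient⇒∋ R a b₂ hall S₂ lt₂

  in₁ : ∀ {v} → N₁ v ≡ true → N₁ v ∨ N₂ v ≡ true
  in₁ {v} p = cong (_∨ N₂ v) p

  in₂ : ∀ {v} → N₂ v ≡ true → N₁ v ∨ N₂ v ≡ true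
  in₂ {v} p = trans (cong (N₁ v ∨_) p) (Bool.∨-zeroʳ (N₁ v))

  via₁ : ∀ {u v} → Dec (v ≡ b₁) → Dec (u ≡ a) → S₁ u ≡ true → R u v ≡ true → N₁ v ∨ N₂ v ≡ true
  via₁ (no v≢)    _          s r = in₁ (N-intro (remove R a b₁) S₁ s (remove-otherʳ R a b₁ v≢ r))
  via₁ (yes _)    (no u≢)    s r = in₁ (N-intro (remove R a b₁) S₁ s (remove-otherˡ R a b₁ u≢ r))
  -- The edge from `a` to `b₁` is gone from the first graph but present in the second, and `a` lies
  -- in `S₂`.
  via₁ (yes refl) (yes refl) s r = in₂ (N-intro (remove R a b₂) S₂ ∋₂ (remove-otherʳ R a b₂ ne r))

  via₂ : ∀ {u v} → Dec (v ≡ b₂) → Dec (u ≡ a) → S₂ u ≡ true → R u v ≡ true → N₁ v ∨ N₂ v ≡ true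
  via₂ (no v≢)    _          s r = in₂ (N-intro (remove R a b₂) S₂ s (remove-otherʳ R a b₂ v≢ r))
  via₂ (yes _)    (no u≢)    s r = in₂ (N-intro (remove R a b₂) S₂ s (remove-otherˡ R a b₂ u≢ r))
  via₂ (yes refl) (yes refl) s r = in₁ (N-intro (remove R a b₁) S₁ ∋₁ (remove-otherʳ R a b₁ (ne ∘ sym) r))

  N-U : ∀ v → N R U v ≡ true → N₁ v ∨ N₂ v ≡ true
  N-U v p with u , s , r ← N-elim R U p with ∨-true {S₁ u} s
  ... | inj₁ s₁ = via₁ (v ≟ b₁) (u ≟ a) s₁ r
  ... | inj₂ s₂ = via₂ (v ≟ b₂) (u ≟ a) s₂ r

  N-D : ∀ v → N R D v ≡ true → N₁ v ∧ N₂ v ≡ true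
  N-D v p with u , d , r ← N-elim R D p with u ≟ a
  ... | yes _ = contradiction (proj₂ (∧-true {I u} d)) λ ()
  ... | no u≢ with s₁ , s₂ ← ∧-true {S₁ u} (proj₁ (∧-true {I u} d)) =
    ∧-intro (N-intro (remove R a b₁) S₁ s₁ (remove-otherˡ R a b₁ u≢ r))
            (N-intro (remove R a b₂) S₂ s₂ (remove-otherˡ R a b₂ u≢ r))

  incl-excl : ∀ (f g : Fin n → Bool) →
              count f + count g ≡ count (λ u → f u ∨ g u) + count (λ u → f u ∧ g u)
  incl-excl f g = begin
    count f + count g                                     ≡⟨ cong₂ _+_ (count≡sum f) (count≡sum g) ⟩
    sumFin (bit ∘ f) + sumFin (bit ∘ g)                   ≡⟨ sum-+ (bit ∘ f) (bit ∘ g) ⟨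
    sumFin (λ u → bit (f u) + bit (g u))                  ≡⟨ sum-cong (λ u → aux (f u) (g u)) ⟩
    sumFin (λ u → bit (f u ∨ g u) + bit (f u ∧ g u))      ≡⟨ sum-+ (λ u → bit (f u ∨ g u)) (λ u → bit (f u ∧ g u)) ⟩
    _                                                     ≡⟨ cong₂ _+_ (count≡sum (λ u → f u ∨ g u)) (count≡sum (λ u → f u ∧ g u)) ⟨
    count (λ u → f u ∨ g u) + count (λ u → f u ∧ g u)     ∎
    where
    open ≡-Reasoning
    aux : ∀ x y → bit x + bit y ≡ bit (x ∨ y) + bit (x ∧ y)
    aux true  true  = refl
    aux true  false = refl
    aux false y     = sym (+-identityʳ (bit y))

  I≤D+1 : count I ≤ count D + 1
  I≤D+1 = begin
    count I                                           ≡⟨ count≡sum I ⟩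
    sumFin (bit ∘ I)                                  ≤⟨ sum-mono (λ u → aux (I u) (does (u ≟ a))) ⟩
    sumFin (λ u → bit (D u) + bit (does (u ≟ a)))     ≡⟨ sum-+ (bit ∘ D) (λ u → bit (does (u ≟ a))) ⟩
    _                                                 ≡⟨ cong₂ _+_ (count≡sum D) (count≡sum (λ u → does (u ≟ a))) ⟨
    count D + count (λ u → does (u ≟ a))              ≡⟨ cong (count D +_) (count-single (λ u → does (u ≟ a)) (dec-true (a ≟ a) refl) (λ b → does-true (b ≟ a))) ⟩
    count D + 1                                       ∎
    where
    open ≤-Reasoning
    aux : ∀ x y → bit x ≤ bit (x ∧ not y) + bit y
    aux false y     = z≤n
    aux true  true  = ≤-refl
    aux true  false = ≤-refl

  -- Two deficient sets give a surplus of 2 over the neighbourhoods, while Hall's condition for `U`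
  -- and `D` allows only the 1 lost by removing `a`.
  bound : suc (count N₁ + suc (count N₂)) ≤ count N₁ + suc (count N₂)
  bound = begin
    suc (count N₁) + suc (count N₂)                  ≤⟨ +-mono-≤ lt₁ lt₂ ⟩
    count S₁ + count S₂                              ≡⟨ incl-excl S₁ S₂ ⟩
    count U + count I                                ≤⟨ +-monoʳ-≤ (count U) I≤D+1 ⟩
    count U + (count D + 1)                          ≡⟨ +-assoc (count U) (count D) 1 ⟨
    count U + count D + 1                            ≤⟨ +-monoˡ-≤ 1 (+-mono-≤ (≤-trans (hall U) (count-mono N-U)) (≤-trans (hall D) (count-mono N-D))) ⟩
    count (λ v → N₁ v ∨ N₂ v) + count (λ v → N₁ v ∧ N₂ v) + 1 ≡⟨ cong (_+ 1) (incl-excl N₁ N₂) ⟨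
    count N₁ + count N₂ + 1                          ≡⟨ +-assoc (count N₁) (count N₂) 1 ⟩
    count N₁ + (count N₂ + 1)                        ≡⟨ cong (count N₁ +_) (+-comm (count N₂) 1) ⟩
    count N₁ + suc (count N₂)                        ∎
    where open ≤-Reasoning

SDR : ∀ {n} → Graph n → Set
SDR {n} R = Σ (Fin n → Fin n) λ f → Injective _≡_ _≡_ f × (∀ u → R u (f u) ≡ true)

-- Hall's condition for singletons provides a neighbour of each vertex; for two-element sets it
-- forbids that two vertices share their only neighbour.
hall⇒SDR-sparse : ∀ {n} (R : Graph n) → Hall R → (∀ u → count (R u) ≤ 1) → SDR R
hall⇒SDR-sparse {n} R hall sparse = f , inj , f-R
  where
  single : Fin n → Fin n → Bool
  single u w = does (w ≟ u)

  nbr : ∀ u → ∃[ v ] R u v ≡ true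
  nbr u with v , p ← count-pos⁻¹ (N R (single u))
                       (≤-trans (count-pos (single u) {u} (dec-true (u ≟ u) refl)) (hall (single u)))
        with w , s , r ← N-elim R (single u) p
        with refl ← does-true (w ≟ u) s = v , r

  f : Fin n → Fin n
  f u = proj₁ (nbr u)

  f-R : ∀ u → R u (f u) ≡ true
  f-R u = proj₂ (nbr u)

  inj : Injective _≡_ _≡_ f
  inj {u} {w} e with u ≟ w
  ... | yes p = p
  ... | no ne = contradiction
    (≤-trans (count-two two {u} {w} ne (cong (_∨ single w u) (dec-true (u ≟ u) refl))
               (trans (cong (single u w ∨_) (dec-true (w ≟ w) refl)) (Bool.∨-zeroʳ (single u w))))
      (≤-trans (hall two) (unique⇒count≤1 (N R two) (λ p q → trans (only p) (sym (only q))))))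
    λ { (s≤s ()) }
    where
    two : Fin n → Bool
    two x = single u x ∨ single w x

    only : ∀ {v} → N R two v ≡ true → v ≡ f u
    only p with x , t , r ← N-elim R two p with ∨-true {single u x} t
    ... | inj₁ q with refl ← does-true (x ≟ u) q = count≤1⇒unique (R u) (sparse u) r (f-R u)
    ... | inj₂ q with refl ← does-true (x ≟ w) q = trans (count≤1⇒unique (R w) (sparse w) r (f-R w)) (sym e)

-- As long as some vertex has two neighbours, `rado` removes an edge there without harming Hall's
-- condition. The number `k` bounds the remaining edges and ends the recursion at the sparse case.
hall⇒SDR : ∀ {n} (R : Graph n) → Hall R → SDR R
hall⇒SDR R hall = go _ R ≤-refl hall
  where
  go : ∀ {n} k (R : Graph n) → sumFin (λ u → count (R u)) ≤ k → Hall R → SDR R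
  weaken : ∀ {n} (R : Graph n) a b → SDR (remove R a b) → SDR R
  weaken R a b (f , inj , fR) = f , inj , λ u → remove-⊆ R a b (fR u)

  go k R le hall with any? (λ u → 2 ≤? count (R u))
  go k R le hall | no none = hall⇒SDR-sparse R hall (λ u → ≤-pred (≰⇒> (λ p → none (u , p))))
  go k R le hall | yes (a , p) with b₁ , b₂ , ne , r₁ , r₂ ← count-two⁻¹ (R a) p
    with k | rado R ne r₁ r₂ hall
  ... | zero  | _      = contradiction (≤-trans (remove-fewer R a b₁ r₁) le) λ ()
  ... | suc k | inj₁ h = weaken R a b₁ (go k (remove R a b₁) (≤-pred (≤-trans (remove-fewer R a b₁ r₁) le)) h)
  ... | suc k | inj₂ h = weaken R a b₂ (go k (remove R a b₂) (≤-pred (≤-trans (remove-fewer R a b₂ r₂) le)) h)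

Symmetric : ∀ {n} → Graph n → Set
Symmetric {n} G = ∀ (u v : Fin n) → G u v ≡ G v u

Regular : ∀ {n} → ℕ → Graph n → Set
Regular {n} r G = ∀ (v : Fin n) → deg G v ≡ r

ProperColouring : ∀ {n} → Graph n → (Fin n → Bool) → Set
ProperColouring {n} G c = ∀ (u v : Fin n) → G u v ≡ true → c u ≢ c v

-- All edges leaving `S` arrive in its neighbourhood, which can absorb only `suc r` of them per
-- vertex.
regular⇒hall : ∀ {n r} (G : Graph n) → Symmetric G → Regular (suc r) G → Hall G
regular⇒hall {n} {r} G sy reg S = *-cancelˡ-≤ (suc r) (begin
  suc r * count S          ≡⟨ pairs-regular G S reg ⟨
  pairs G S all            ≤⟨ pairs-mono G S all all (N G S) (λ u v s _ g → refl , N-intro G S s g) ⟩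
  pairs G all (N G S)      ≡⟨ pairs-transpose G all (N G S) ⟩
  pairs (λ v u → G u v) (N G S) all ≡⟨ pairs-regular (λ v u → G u v) (N G S) (λ v → trans (count-cong λ u → sy u v) (reg v)) ⟩
  suc r * count (N G S)    ∎)
  where open ≤-Reasoning

_─_ : ∀ {n} → Graph n → Graph n → Graph n
(G ─ P) u v = G u v ∧ not (P u v)

-- Only the values of `f` on the class of colour `true` become matching edges. The other class is
-- covered because `f` is onto and a preimage of a `false` vertex, being adjacent to it, has colour
-- `true`.
SDR⇒perfect-matching : ∀ {n} (G : Graph n) {c} → Symmetric G → ProperColouring G c → SDR G →
                       ∃[ P ] PerfectMatching G P
SDR⇒perfect-matching {n} G {c} sy col (f , f-inj , f-G) = P , (P-sym , P-⊆) , P-deg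
  where
  P : Graph n
  P u v = (c u ∧ does (f u ≟ v)) ∨ (c v ∧ does (f v ≟ u))

  P-sym : Symmetric P
  P-sym u v = Bool.∨-comm (c u ∧ does (f u ≟ v)) (c v ∧ does (f v ≟ u))

  P-cases : ∀ {u v} → P u v ≡ true → (c u ≡ true × f u ≡ v) ⊎ (c v ≡ true × f v ≡ u)
  P-cases {u} {v} p with ∨-true {c u ∧ does (f u ≟ v)} p
  ... | inj₁ q with a , b ← ∧-true {c u} q = inj₁ (a , does-true (f u ≟ v) b)
  ... | inj₂ q with a , b ← ∧-true {c v} q = inj₂ (a , does-true (f v ≟ u) b)

  P-⊆ : ∀ u v → P u v ≡ true → G u v ≡ true
  P-⊆ u v p with P-cases p
  ... | inj₁ (_ , refl) = f-G u
  ... | inj₂ (_ , refl) = trans (sy u v) (f-G v)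

  P-intro : ∀ {u v} → c u ≡ true → f u ≡ v → P u v ≡ true
  P-intro {u} {v} cu e rewrite cu | dec-true (f u ≟ v) e = refl

  P-deg-true : ∀ u → c u ≡ true → deg P u ≡ 1
  P-deg-true u cu = count-single (P u) {f u} (P-intro cu refl) λ v p → unique v (P-cases p)
    where
    unique : ∀ v → (c u ≡ true × f u ≡ v) ⊎ (c v ≡ true × f v ≡ u) → v ≡ f u
    unique v (inj₁ (_ , e)) = sym e
    unique v (inj₂ (cv , refl)) = contradiction (trans cv (sym cu)) (col v u (f-G v))

  P-deg-false : ∀ u → c u ≡ false → deg P u ≡ 1
  P-deg-false u cu with w , refl ← injective⇒surjective f f-inj u =
    count-single (P u) {w} (trans (P-sym u w) (P-intro cw refl)) λ v p → unique v (P-cases p)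
    where
    cw : c w ≡ true
    cw = Bool.¬-not (λ e → col w u (f-G w) (trans e (sym cu)))
    unique : ∀ v → (c u ≡ true × f u ≡ v) ⊎ (c v ≡ true × f v ≡ u) → v ≡ w
    unique v (inj₁ (t , _)) = contradiction cu (true≢false t)
    unique v (inj₂ (_ , e)) = f-inj e

  P-deg : ∀ u → deg P u ≡ 1
  P-deg u with c u Bool.≟ true
  ... | yes cu = P-deg-true u cu
  ... | no ¬cu = P-deg-false u (Bool.¬-not ¬cu)

perfect-matching : ∀ {n r} (G : Graph n) {c} → Symmetric G → Regular (suc r) G → ProperColouring G c →
                   ∃[ P ] PerfectMatching G P
perfect-matching G sy reg col = SDR⇒perfect-matching G sy col (hall⇒SDR G (regular⇒hall G sy reg))

module _ {n : ℕ} {G P : Graph n} (sp : SpanningSub G P) where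

  ─-bit : ∀ u v → bit (G u v) ≡ bit ((G ─ P) u v) + bit (P u v)
  ─-bit u v = bit-difference (proj₂ sp u v)

  ─-spanning : Symmetric G → SpanningSub G (G ─ P)
  ─-spanning sy = (λ u v → cong₂ (λ a b → a ∧ not b) (sy u v) (proj₁ sp u v)) , (λ u v e → proj₁ (∧-true e))

  ─-regular : ∀ {r} → Regular (suc r) G → Regular 1 P → Regular r (G ─ P)
  ─-regular {r} rG rP v = suc-injective (begin
    suc (deg (G ─ P) v)      ≡⟨ +-comm 1 _ ⟩
    deg (G ─ P) v + 1        ≡⟨ cong (deg (G ─ P) v +_) (rP v) ⟨
    deg (G ─ P) v + deg P v  ≡⟨ count-+ (─-bit v) ⟨
    deg G v                  ≡⟨ rG v ⟩
    suc r                    ∎)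
    where open ≡-Reasoning

-- Connected 2-factors

reach-trans : ∀ {n} {G : Graph n} {u v w} → Reach G u v → Reach G v w → Reach G u w
reach-trans here       q = q
reach-trans (step e p) q = step e (reach-trans p q)

reach-sym : ∀ {n} {G : Graph n} → Symmetric G → ∀ {u v} → Reach G u v → Reach G v u
reach-sym sy here       = here
reach-sym sy (step e p) = reach-trans (reach-sym sy p) (step (trans (sy _ _) e) here)

reach-map : ∀ {m n} {G : Graph m} {H : Graph n} (π : Fin m → Fin n) →
            (∀ u v → G u v ≡ true → Reach H (π u) (π v)) →
            ∀ {u v} → Reach G u v → Reach H (π u) (π v)
reach-map π h here       = here
reach-map π h (step e p) = reach-trans (h _ _ e) (reach-map π h p)

reach-⊆ : ∀ {n} {G H : Graph n} → (∀ u v → G u v ≡ true → H u v ≡ true) →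
          ∀ {u v} → Reach G u v → Reach H u v
reach-⊆ h = reach-map (λ u → u) (λ u v e → step (h u v e) here)

reach-closed : ∀ {n} {G : Graph n} (X : Fin n → Bool) →
               (∀ u v → X u ≡ true → G u v ≡ true → X v ≡ true) →
               ∀ {u v} → Reach G u v → X u ≡ true → X v ≡ true
reach-closed X h here       x = x
reach-closed X h (step e p) x = reach-closed X h p (h _ _ x e)

hamiltonian⇒connected : ∀ {n} {F : Graph n} → Symmetric F → HamiltonianCycle F → Connected F
hamiltonian⇒connected {suc n} {F} sy (_ , σ , σ-inj , adj) u v
  with i , refl ← injective⇒surjective σ σ-inj u | j , refl ← injective⇒surjective σ σ-inj v =
  reach-trans (reach-sym sy (from-zero i)) (from-zero j)
  where
  from-zero : ∀ i → Reach F (σ zero) (σ i)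
  from-zero = <-weakInduction (λ i → Reach F (σ zero) (σ i)) here λ i p → reach-trans p
    (step (proj₂ (adj (σ (inject₁ i)) (σ (suc i)))
            (inject₁ i , suc i , refl , refl , inj₁ (inj₁ (cong suc (sym (toℕ-inject₁ i)))))) here)

module _ {n : ℕ} (g : Fin n → Fin n) (g-inj : Injective _≡_ _≡_ g) (x : Fin n) where

  iterate : ℕ → Fin n
  iterate zero    = x
  iterate (suc k) = g (iterate k)

  iterate-cancel : ∀ i d → iterate i ≡ iterate (i + d) → iterate d ≡ x
  iterate-cancel zero    d e = sym e
  iterate-cancel (suc i) d e = iterate-cancel i d (g-inj e)

  module _ {F : Graph n} (conn : Connected F) (gF : ∀ u v → F u v ≡ true → g u ≡ v ⊎ g v ≡ u) where

    -- An edge of `F` leads one step forward or backward along `g`. The period wraps the index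
    -- `d - 1` to 0 and back, so the first `d` iterates are closed under adjacency.
    orbit : ∀ d → 0 < d → iterate d ≡ x → ∀ {u v} → Reach F u v →
            (∃[ k ] (k < d × iterate k ≡ u)) → ∃[ k ] (k < d × iterate k ≡ v)
    orbit d 0<d per here o = o
    orbit d 0<d per (step {u} {w} e p) (k , k<d , refl) = orbit d 0<d per p (next k k<d (gF u w e))
      where
      next : ∀ k → k < d → g (iterate k) ≡ w ⊎ g w ≡ iterate k → ∃[ l ] (l < d × iterate l ≡ w)
      next k k<d (inj₁ q) with suc k <? d
      ... | yes lt = suc k , lt , q
      ... | no ge with refl ← ≤-antisym k<d (≮⇒≥ ge) = 0 , 0<d , trans (sym per) q
      next (suc k) k<d (inj₂ q) = k , <⇒≤ k<d , sym (g-inj q)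
      next zero k<d (inj₂ q) = back d 0<d per
        where
        back : ∀ d → 0 < d → iterate d ≡ x → ∃[ l ] (l < d × iterate l ≡ w)
        back (suc d) _ per = d , ≤-refl , g-inj (trans per (sym q))

    -- Connectedness puts every vertex among the first `d` iterates, and different vertices have
    -- different indices.
    period≥n : ∀ d → 0 < d → iterate d ≡ x → n ≤ d
    period≥n d 0<d per = injective⇒≤ {f = λ v → fromℕ< (proj₁ (proj₂ (index v)))} λ {u} {v} e →
      trans (sym (proj₂ (proj₂ (index u)))) (trans (cong iterate
        (trans (sym (toℕ-fromℕ< _)) (trans (cong toℕ e) (toℕ-fromℕ< _)))) (proj₂ (proj₂ (index v))))
      where
      index : ∀ v → ∃[ k ] (k < d × iterate k ≡ v)
      index v = orbit d 0<d per (conn x v) (0 , 0<d , refl)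

    -- The window `j < n + i` reaches beyond the indices below `n`: `iterate-n` compares a positive
    -- index with `n` itself.
    iterate-distinct : ∀ {i j} → i < j → j < n + i → iterate i ≢ iterate j
    iterate-distinct {i} {j} i<j j<n+i e = <⇒≱ d<n (period≥n d 0<d (iterate-cancel i d (trans e (cong iterate (sym i+d)))))
      where
      d : ℕ
      d = j ∸ i
      i+d : i + d ≡ j
      i+d = m+[n∸m]≡n (<⇒≤ i<j)
      0<d : 0 < d
      0<d = m<n⇒0<n∸m i<j
      d<n : d < n
      d<n = +-cancelʳ-< i d n (subst (_< n + i) (trans (sym i+d) (+-comm i d)) j<n+i)

    σ : Fin n → Fin n
    σ i = iterate (toℕ i)

    σ-injective : Injective _≡_ _≡_ σ
    σ-injective {i} {j} e with <-cmp (toℕ i) (toℕ j)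
    ... | tri≈ _ p _ = toℕ-injective p
    ... | tri< p _ _ = contradiction e (iterate-distinct p (<-≤-trans (toℕ<n j) (m≤m+n n _)))
    ... | tri> _ _ p = contradiction (sym e) (iterate-distinct p (<-≤-trans (toℕ<n i) (m≤m+n n _)))

    iterate-n : iterate n ≡ x
    iterate-n with j , e ← injective⇒surjective σ σ-injective (iterate n) = aux (toℕ j) (toℕ<n j) e
      where
      aux : ∀ k → k < n → iterate k ≡ iterate n → iterate n ≡ x
      aux zero    lt e = sym e
      aux (suc k) lt e = contradiction e (iterate-distinct lt (m<m+n n (s≤s z≤n)))

    σ-next : ∀ {i j} → CycNext i j → g (σ i) ≡ σ j
    σ-next (inj₁ e) = cong iterate (sym e)
    σ-next (inj₂ (e , z)) = trans (cong iterate e) (trans iterate-n (cong iterate (sym z)))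

    σ-next⁻¹ : ∀ {i j} → g (σ i) ≡ σ j → CycNext i j
    σ-next⁻¹ {i} {j} e with suc (toℕ i) <? n
    ... | yes lt = inj₁ (trans (cong toℕ (σ-injective {j} {fromℕ< lt}
                     (trans (sym e) (cong iterate (sym (toℕ-fromℕ< lt)))))) (toℕ-fromℕ< lt))
    ... | no ge = inj₂ (last , first (toℕ j) refl)
      where
      last : suc (toℕ i) ≡ n
      last = ≤-antisym (toℕ<n i) (≮⇒≥ ge)
      first : ∀ k → toℕ j ≡ k → toℕ j ≡ 0
      first zero    p = p
      first (suc k) p = contradiction (trans (sym iterate-n) (trans (cong iterate (sym last)) e))
        (iterate-distinct (subst (0 <_) (sym p) (s≤s z≤n)) (<-≤-trans (toℕ<n j) (m≤m+n n _)))

    cyclic⇒hamiltonian : 3 ≤ n → Symmetric F → (∀ u → F u (g u) ≡ true) → HamiltonianCycle F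
    cyclic⇒hamiltonian 3≤n sy Fg = 3≤n , σ , σ-injective , λ u v → to u v , from u v
      where
      to : ∀ u v → F u v ≡ true → ∃[ i ] ∃[ j ] (σ i ≡ u × σ j ≡ v × (CycNext i j ⊎ CycNext j i))
      to u v f with i , refl ← injective⇒surjective σ σ-injective u
                  | j , refl ← injective⇒surjective σ σ-injective v with gF u v f
      ... | inj₁ e = i , j , refl , refl , inj₁ (σ-next⁻¹ e)
      ... | inj₂ e = i , j , refl , refl , inj₂ (σ-next⁻¹ e)
      from : ∀ u v → (∃[ i ] ∃[ j ] (σ i ≡ u × σ j ≡ v × (CycNext i j ⊎ CycNext j i))) → F u v ≡ true
      from u v (i , j , refl , refl , inj₁ s) = trans (cong (F (σ i)) (sym (σ-next s))) (Fg (σ i))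
      from u v (i , j , refl , refl , inj₂ s) =
        trans (sy (σ i) (σ j)) (trans (cong (F (σ j)) (sym (σ-next s))) (Fg (σ j)))

─-cases : ∀ {n} (F P : Graph n) {u v} → F u v ≡ true → P u v ≡ true ⊎ (F ─ P) u v ≡ true
─-cases F P {u} {v} f with P u v
... | true  = inj₁ refl
... | false = inj₂ (∧-intro f refl)

-- A connected bipartite 2-regular graph is traversed by leaving one colour
-- class along a perfect matching and the other along its complement.
connected⇒hamiltonian : ∀ {n} {F : Graph n} {c} → 3 ≤ n → Symmetric F → Regular 2 F →
                        ProperColouring F c → Connected F → HamiltonianCycle F
connected⇒hamiltonian {suc n} {F} {c} 3≤n sy reg col conn =
  traverse (perfect-matching F sy reg col)
  where
  traverse : ∃[ P ] PerfectMatching F P → HamiltonianCycle F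
  traverse (P , spP@(P-sym , P-⊆) , P-reg) =
    cyclic⇒hamiltonian g g-inj zero conn gF 3≤n sy Fg
    where
    Q : Graph (suc n)
    Q = F ─ P

    spQ : SpanningSub F Q
    spQ = ─-spanning spP sy

    mate : ∀ (P : Graph (suc n)) → Regular 1 P → Fin (suc n) → Fin (suc n)
    mate P r u = proj₁ (count-single⁻¹ (P u) (r u))

    mate-P : ∀ P r u → P u (mate P r u) ≡ true
    mate-P P r u = proj₁ (proj₂ (count-single⁻¹ (P u) (r u)))

    mate-unique : ∀ P r {u v} → P u v ≡ true → mate P r u ≡ v
    mate-unique P r {u} {v} p = sym (proj₂ (proj₂ (count-single⁻¹ (P u) (r u))) v p)

    mate-injective : ∀ P r → Symmetric P → Injective _≡_ _≡_ (mate P r)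
    mate-injective P r s {u} {v} e = count≤1⇒unique (P (mate P r u)) (≤-reflexive (r _))
      (trans (s _ u) (mate-P P r u))
      (trans (s _ v) (trans (cong (P v) e) (mate-P P r v)))

    Q-reg : Regular 1 Q
    Q-reg = ─-regular spP reg P-reg

    p q g : Fin (suc n) → Fin (suc n)
    p = mate P P-reg
    q = mate Q Q-reg
    g u = if c u then p u else q u

    Fg : ∀ u → F u (g u) ≡ true
    Fg u with c u
    ... | true  = P-⊆ u (p u) (mate-P P P-reg u)
    ... | false = proj₂ spQ u (q u) (mate-P Q Q-reg u)

    -- An edge of `P` is traversed from its `true` end, an edge of `Q` from its `false` end.
    gF : ∀ u v → F u v ≡ true → g u ≡ v ⊎ g v ≡ u
    gF u v f with c u in cu | c v in cv | ─-cases F P f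
    ... | true  | _     | inj₁ e = inj₁ (mate-unique P P-reg e)
    ... | true  | false | inj₂ e = inj₂ (mate-unique Q Q-reg (trans (proj₁ spQ v u) e))
    ... | false | true  | inj₁ e = inj₂ (mate-unique P P-reg (trans (P-sym v u) e))
    ... | false | _     | inj₂ e = inj₁ (mate-unique Q Q-reg e)
    ... | true  | true  | inj₂ _ = contradiction (trans cu (sym cv)) (col u v f)
    ... | false | false | inj₁ _ = contradiction (trans cu (sym cv)) (col u v f)

    -- Each step changes the colour, so two vertices with the same successor use the same matching,
    -- and injectivity is that of a single `mate`.
    same-colour : ∀ u v → g u ≡ g v → c u ≡ c v
    same-colour u v e = trans (Bool.¬-not (col u (g u) (Fg u)))
      (trans (cong (not ∘ c) e) (sym (Bool.¬-not (col v (g v) (Fg v)))))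

    g-inj : Injective _≡_ _≡_ g
    g-inj {u} {v} e = aux (same-colour u v e) e
      where
      aux : c u ≡ c v → g u ≡ g v → u ≡ v
      aux same e with c u | c v
      ... | true  | true  = mate-injective P P-reg P-sym e
      ... | false | false = mate-injective Q Q-reg (proj₁ spQ) e

-- Edge cuts

bit-not : ∀ b → 1 ≡ bit b + bit (not b)
bit-not true  = refl
bit-not false = refl

pairs-⊆ : ∀ {m n} {R R′ : Fin m → Fin n → Bool} S T → (∀ u v → R u v ≡ true → R′ u v ≡ true) →
          pairs R S T ≤ pairs R′ S T
pairs-⊆ S T h = sum-mono λ u → sum-mono λ v → bit-mono λ e →
  let s , tr = ∧-true {S u} e ; t , r = ∧-true tr in ∧-intro s (∧-intro t (h u v r))

pairs-splitʳ : ∀ {m n} (R : Fin m → Fin n → Bool) S T T₁ T₂ →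
               (∀ v → bit (T v) ≡ bit (T₁ v) + bit (T₂ v)) →
               pairs R S T ≡ pairs R S T₁ + pairs R S T₂
pairs-splitʳ R S T T₁ T₂ h = trans (pairs-transpose R S T)
  (trans (pairs-splitˡ (λ v u → R u v) T T₁ T₂ S h)
  (sym (cong₂ _+_ (pairs-transpose R S T₁) (pairs-transpose R S T₂))))

pairs-sym : ∀ {n} {G : Graph n} → Symmetric G → ∀ S T → pairs G S T ≡ pairs G T S
pairs-sym {G = G} sy S T = trans (pairs-transpose G S T)
  (sum-cong λ v → sum-cong λ u → cong (λ g → bit (T v ∧ S u ∧ g)) (sy u v))

cutCount≡pairs : ∀ {n} (X : Fin n → Bool) (P : Graph n) → cutCount X P ≡ pairs P X (not ∘ X)
cutCount≡pairs X P = sum-cong λ u → aux (X u) (λ v → not (X v) ∧ P u v)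
  where
  aux : ∀ {n} x (f : Fin n → Bool) → (if x then count f else 0) ≡ sumFin (λ v → bit (x ∧ f v))
  aux     true  f = count≡sum f
  aux {n} false f = sym (sum-0 {n} (λ _ → 0) (λ _ → refl))

module _ {n : ℕ} (X c : Fin n → Bool) where

  X̄ X₁ X₀ : Fin n → Bool
  X̄ = not ∘ X
  X₁ u = X u ∧ c u
  X₀ u = X u ∧ not (c u)

  X-split : ∀ u → bit (X u) ≡ bit (X₁ u) + bit (X₀ u)
  X-split u with X u
  ... | true  = bit-not (c u)
  ... | false = refl

  cut-split : ∀ P → cutCount X P ≡ pairs P X₁ X̄ + pairs P X₀ X̄
  cut-split P = trans (cutCount≡pairs X P) (pairs-splitˡ P X X₁ X₀ X̄ X-split)

  pairs-colours : ∀ {P} → ProperColouring P c → ∀ {S T} b →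
                  (∀ u → S u ≡ true → c u ≡ b) → (∀ u → T u ≡ true → c u ≡ b) → pairs P S T ≡ 0
  pairs-colours {P} col b hS hT = pairs-none P λ u v s t →
    Bool.¬-not λ p → col u v p (trans (hS u s) (sym (hT v t)))

  module _ {P : Graph n} {r : ℕ} (sy : Symmetric P) (reg : Regular r P) (col : ProperColouring P c) where

    degree-sum : ∀ S → r * count S ≡ pairs P S X₁ + pairs P S X₀ + pairs P S X̄
    degree-sum S = trans (sym (pairs-regular P S reg)) (trans (pairs-splitʳ P S all X X̄ (bit-not ∘ X))
      (cong (_+ pairs P S X̄) (pairs-splitʳ P S X X₁ X₀ X-split)))

    -- Edges inside `X` join its two colour classes and so contribute equally to both degree sums.
    -- What remains of each sum is the number of edges that leave `X` from that class; the identity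
    -- is written crosswise to avoid subtraction.
    balance : r * count X₁ + pairs P X₀ X̄ ≡ r * count X₀ + pairs P X₁ X̄
    balance = begin
      r * count X₁ + pairs P X₀ X̄
        ≡⟨ cong (_+ pairs P X₀ X̄) (trans (degree-sum X₁) (cong (λ k → k + pairs P X₁ X₀ + pairs P X₁ X̄)
             (pairs-colours col true (λ u → proj₂ ∘ ∧-true {X u}) (λ u → proj₂ ∘ ∧-true {X u})))) ⟩
      pairs P X₁ X₀ + pairs P X₁ X̄ + pairs P X₀ X̄
        ≡⟨ cong (λ k → k + pairs P X₁ X̄ + pairs P X₀ X̄) (pairs-sym sy X₁ X₀) ⟩
      pairs P X₀ X₁ + pairs P X₁ X̄ + pairs P X₀ X̄
        ≡⟨ +-assoc (pairs P X₀ X₁) _ _ ⟩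
      pairs P X₀ X₁ + (pairs P X₁ X̄ + pairs P X₀ X̄)
        ≡⟨ cong (pairs P X₀ X₁ +_) (+-comm (pairs P X₁ X̄) _) ⟩
      pairs P X₀ X₁ + (pairs P X₀ X̄ + pairs P X₁ X̄)
        ≡⟨ +-assoc (pairs P X₀ X₁) _ _ ⟨
      pairs P X₀ X₁ + pairs P X₀ X̄ + pairs P X₁ X̄
        ≡⟨ cong (λ k → k + pairs P X₀ X̄ + pairs P X₁ X̄) (+-identityʳ _) ⟨
      pairs P X₀ X₁ + 0 + pairs P X₀ X̄ + pairs P X₁ X̄
        ≡⟨ cong (_+ pairs P X₁ X̄) (trans (degree-sum X₀) (cong (λ k → pairs P X₀ X₁ + k + pairs P X₀ X̄)
             (pairs-colours col false (λ u → not-true ∘ proj₂ ∘ ∧-true {X u}) (λ u → not-true ∘ proj₂ ∘ ∧-true {X u})))) ⟨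
      r * count X₀ + pairs P X₁ X̄ ∎
      where
      open ≡-Reasoning
      not-true : ∀ {b} → not b ≡ true → b ≡ false
      not-true {false} _ = refl

3∤1 : ∀ a b → 3 * a + 1 ≢ 3 * b
3∤1 a b e with () ← ∣1⇒≡1 (∣m+n∣m⇒∣n (subst (3 ∣_) (sym e) (m∣m*n b)) (m∣m*n {3} a))

data OneSided (a b x y : ℕ) : Set where
  left  : a ≡ suc b → x ≡ 3 → y ≡ 0 → OneSided a b x y
  right : b ≡ suc a → x ≡ 0 → y ≡ 3 → OneSided a b x y

-- The equation makes `x` and `y` congruent modulo 3, which excludes the splits 1 + 2 and 2 + 1. In
-- the two others, cancelling 3 gives the difference of one vertex.
oneSided : ∀ a b x y → 3 * a + y ≡ 3 * b + x → x + y ≡ 3 → OneSided a b x y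
oneSided a b 0 .3 e refl = right (*-cancelˡ-≡ b (suc a) 3
  (trans (sym (+-identityʳ (3 * b))) (trans (sym e) (trans (+-comm (3 * a) 3) (sym (*-suc 3 a)))))) refl refl
oneSided a b 1 .2 e refl = contradiction (+-cancelʳ-≡ 1 (3 * a + 1) (3 * b) (trans (+-assoc (3 * a) 1 1) e)) (3∤1 a b)
oneSided a b 2 .1 e refl = contradiction (sym (+-cancelʳ-≡ 1 (3 * a) (3 * b + 1) (trans e (sym (+-assoc (3 * b) 1 1))))) (3∤1 b a)
oneSided a b 3 .0 e refl = left (*-cancelˡ-≡ a (suc b) 3
  (trans (sym (+-identityʳ (3 * a))) (trans e (trans (+-comm (3 * b) 3) (sym (*-suc 3 b)))))) refl refl

three-cut-oneSided : ∀ {n} {G : Graph n} {c} → Symmetric G → Cubic G → ProperColouring G c →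
  ∀ X → cutCount X G ≡ 3 →
  OneSided (count (X₁ X c)) (count (X₀ X c)) (pairs G (X₁ X c) (X̄ X c)) (pairs G (X₀ X c) (X̄ X c))
three-cut-oneSided {G = G} {c} sy cub col X cut =
  oneSided _ _ _ _ (balance X c sy cub col) (trans (sym (cut-split X c G)) cut)

three-cut⇒tight : ∀ {n} {G : Graph n} {c} → Symmetric G → Cubic G → ProperColouring G c →
                  ∀ X → cutCount X G ≡ 3 → TightCut G X
three-cut⇒tight {G = G} {c} sy cub col X cut P ((P-sym , P-⊆) , P-reg) =
  trans (cut-split X c P) (aux (three-cut-oneSided sy cub col X cut))
  where
  a = count (X₁ X c)
  b = count (X₀ X c)
  p = pairs P (X₁ X c) (X̄ X c)
  q = pairs P (X₀ X c) (X̄ X c)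

  -- This is `balance` for the 1-regular graph `P`. Since `P` lies in `G`, one of `p` and `q`
  -- vanishes, and the other is the imbalance 1.
  eq : a + q ≡ b + p
  eq = subst₂ (λ s t → s + q ≡ t + p) (+-identityʳ a) (+-identityʳ b)
         (balance X c P-sym P-reg (λ u v e → col u v (P-⊆ u v e)))

  p≤ : p ≤ pairs G (X₁ X c) (X̄ X c)
  p≤ = pairs-⊆ (X₁ X c) (X̄ X c) P-⊆
  q≤ : q ≤ pairs G (X₀ X c) (X̄ X c)
  q≤ = pairs-⊆ (X₀ X c) (X̄ X c) P-⊆

  aux : OneSided a b (pairs G (X₁ X c) (X̄ X c)) (pairs G (X₀ X c) (X̄ X c)) → p + q ≡ 1
  aux (left a≡ x≡ y≡) = trans (cong (p +_) q≡0) (trans (+-identityʳ p)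
    (sym (+-cancelˡ-≡ b 1 p (trans (+-comm b 1) (trans (sym a≡) (trans (sym (+-identityʳ a)) (trans (cong (a +_) (sym q≡0)) eq)))))))
    where
    q≡0 : q ≡ 0
    q≡0 = n≤0⇒n≡0 (subst (q ≤_) y≡ q≤)
  aux (right b≡ x≡ y≡) = trans (cong (_+ q) p≡0)
    (+-cancelˡ-≡ a q 1 (trans eq (trans (cong (b +_) p≡0) (trans (+-identityʳ b) (trans b≡ (+-comm 1 a))))))
    where
    p≡0 : p ≡ 0
    p≡0 = n≤0⇒n≡0 (subst (p ≤_) x≡ p≤)

-- Decomposition of a cubic bipartite graph into perfect matchings

record ThreeFactors {n} (G : Graph n) : Set where
  field
    P₁ P₂ P₃ : Graph n
    pm₁ : PerfectMatching G P₁
    pm₂ : PerfectMatching G P₂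
    pm₃ : PerfectMatching G P₃
    -- As an equation of numbers this says both that the matchings cover `G` and that they are
    -- disjoint.
    decompose : ∀ u v → bit (G u v) ≡ bit (P₁ u v) + (bit (P₂ u v) + bit (P₃ u v))

three-factors : ∀ {n} (G : Graph n) {c} → Symmetric G → Cubic G → ProperColouring G c → ThreeFactors G
three-factors G {c} sy cub col = first (perfect-matching G sy cub col)
  where
  first : ∃[ P ] PerfectMatching G P → ThreeFactors G
  first (P₁ , sp₁ , r₁) = second (perfect-matching F (proj₁ spF) rF (λ u v e → col u v (proj₂ spF u v e)))
    where
    F = G ─ P₁
    spF : SpanningSub G F
    spF = ─-spanning sp₁ sy
    rF : Regular 2 F
    rF = ─-regular sp₁ cub r₁
    second : ∃[ P ] PerfectMatching F P → ThreeFactors G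
    second (P₂ , sp₂ , r₂) = record
      { P₁ = P₁ ; P₂ = P₂ ; P₃ = F ─ P₂
      ; pm₁ = sp₁ , r₁
      ; pm₂ = (proj₁ sp₂ , λ u v e → proj₂ spF u v (proj₂ sp₂ u v e)) , r₂
      ; pm₃ = (proj₁ sp₃ , λ u v e → proj₂ spF u v (proj₂ sp₃ u v e)) , ─-regular sp₂ rF r₂
      ; decompose = λ u v → trans (─-bit sp₁ u v) (trans (+-comm (bit (F u v)) (bit (P₁ u v)))
          (cong (bit (P₁ u v) +_) (trans (─-bit sp₂ u v) (+-comm (bit ((F ─ P₂) u v)) (bit (P₂ u v))))))
      }
      where
      sp₃ : SpanningSub F (F ─ P₂)
      sp₃ = ─-spanning sp₂ (proj₁ spF)

module _ {n : ℕ} {G : Graph n} (T : ThreeFactors G) where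
  open ThreeFactors T

  pairs-decompose : ∀ S S′ → pairs G S S′ ≡ pairs P₁ S S′ + (pairs P₂ S S′ + pairs P₃ S S′)
  pairs-decompose S S′ = begin
    sumFin (λ u → sumFin λ v → bit (S u ∧ S′ v ∧ G u v))
      ≡⟨ sum-cong (λ u → trans (sum-cong λ v → aux (S u) (S′ v) (decompose u v))
           (trans (sum-+ (λ v → bit (S u ∧ S′ v ∧ P₁ u v)) (λ v → bit (S u ∧ S′ v ∧ P₂ u v) + bit (S u ∧ S′ v ∧ P₃ u v)))
             (cong (sumFin (λ v → bit (S u ∧ S′ v ∧ P₁ u v)) +_)
               (sum-+ (λ v → bit (S u ∧ S′ v ∧ P₂ u v)) (λ v → bit (S u ∧ S′ v ∧ P₃ u v)))))) ⟩
    sumFin (λ u → row P₁ u + (row P₂ u + row P₃ u))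
      ≡⟨ sum-+ (row P₁) (λ u → row P₂ u + row P₃ u) ⟩
    pairs P₁ S S′ + sumFin (λ u → row P₂ u + row P₃ u)
      ≡⟨ cong (pairs P₁ S S′ +_) (sum-+ (row P₂) (row P₃)) ⟩
    pairs P₁ S S′ + (pairs P₂ S S′ + pairs P₃ S S′) ∎
    where
    open ≡-Reasoning
    row : Graph n → Fin n → ℕ
    row P u = sumFin λ v → bit (S u ∧ S′ v ∧ P u v)
    aux : ∀ s t {a b c d} → bit a ≡ bit b + (bit c + bit d) →
          bit (s ∧ t ∧ a) ≡ bit (s ∧ t ∧ b) + (bit (s ∧ t ∧ c) + bit (s ∧ t ∧ d))
    aux false t     e = refl
    aux true  false e = refl
    aux true  true  e = e

  cut-decompose : ∀ X → cutCount X G ≡ cutCount X P₁ + (cutCount X P₂ + cutCount X P₃)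
  cut-decompose X = trans (cutCount≡pairs X G) (trans (pairs-decompose X (not ∘ X))
    (sym (cong₂ _+_ (cutCount≡pairs X P₁) (cong₂ _+_ (cutCount≡pairs X P₂) (cutCount≡pairs X P₃)))))

  tight⇒three-cut : ∀ X → TightCut G X → cutCount X G ≡ 3
  tight⇒three-cut X tight = trans (cut-decompose X)
    (cong₂ _+_ (tight P₁ pm₁) (cong₂ _+_ (tight P₂ pm₂) (tight P₃ pm₃)))

  edge-in-matching : ∀ u v → G u v ≡ true → Σ (Graph n) λ P → PerfectMatching G P × P u v ≡ true
  edge-in-matching u v e with P₁ u v in e₁ | P₂ u v in e₂ | P₃ u v in e₃ | decompose u v
  ... | true  | _     | _     | _ = P₁ , pm₁ , e₁
  ... | false | true  | _     | _ = P₂ , pm₂ , e₂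
  ... | false | false | true  | _ = P₃ , pm₃ , e₃
  ... | false | false | false | d with () ← trans (sym (cong bit e)) d

-- Cuts of cubic bipartite graphs with connected 2-factors

TwoFactorsConnected : ∀ {n} → Graph n → Set
TwoFactorsConnected {n} G = ∀ (F : Graph n) → TwoFactor G F → Connected F

connected⇒crossing : ∀ {n} {F : Graph n} → Connected F → ∀ (X : Fin n → Bool) {u v} →
                     X u ≡ true → X v ≡ false → 1 ≤ cutCount X F
connected⇒crossing {F = F} conn X {u} {v} xu xv = n≢0⇒n>0 λ none →
  true≢false (reach-closed X (closed none) (conn u v) xu) xv
  where
  closed : cutCount X F ≡ 0 → ∀ u v → X u ≡ true → F u v ≡ true → X v ≡ true
  closed none u v xu f with X v in xv
  ... | true  = refl
  ... | false = contradiction (subst (1 ≤_) (trans (sym (cutCount≡pairs X F)) none)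
                  (pairs-term F {X} {not ∘ X} xu (cong not xv) f)) λ ()

complement-twoFactor : ∀ {n} {G P : Graph n} → Symmetric G → Cubic G → PerfectMatching G P → TwoFactor G (G ─ P)
complement-twoFactor sy cub (sp , r) = ─-spanning sp sy , ─-regular sp cub r

cut-─ : ∀ {n} {G P : Graph n} → SpanningSub G P → ∀ X → cutCount X G ≡ cutCount X (G ─ P) + cutCount X P
cut-─ {G = G} {P} sp X = trans (cutCount≡pairs X G) (trans (pairs-+ {R₁ = G ─ P} {P} {X} (─-bit sp))
  (sym (cong₂ _+_ (cutCount≡pairs X (G ─ P)) (cutCount≡pairs X P))))

module _ {n : ℕ} {G : Graph n} {c : Fin n → Bool} (sy : Symmetric G) (cub : Cubic G) (col : ProperColouring G c)
         (2fc : TwoFactorsConnected G) where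

  -- The three perfect matchings meet the cut equally often modulo 2, each at
  -- least as often as the imbalance of X; any two of them together cross it.
  cut≥3 : ∀ X {u v} → X u ≡ true → X v ≡ false → 3 ≤ cutCount X G
  cut≥3 X {u} {v} xu xv with count (X₁ X c) ℕ.≟ count (X₀ X c)
  ... | no a≢b = subst (3 ≤_) (sym (cut-decompose T X))
          (+-mono-≤ (meets pm₁) (+-mono-≤ (meets pm₂) (meets pm₃)))
    where
    T = three-factors G sy cub col
    open ThreeFactors T
    meets : ∀ {P} → PerfectMatching G P → 1 ≤ cutCount X P
    meets {P} ((P-sym , P-⊆) , r) = n≢0⇒n>0 λ e → a≢b (zero-balance (trans (sym (cut-split X c P)) e))
      where
      zero-balance : pairs P (X₁ X c) (X̄ X c) + pairs P (X₀ X c) (X̄ X c) ≡ 0 → count (X₁ X c) ≡ count (X₀ X c)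
      zero-balance e = *-cancelˡ-≡ _ _ 1 (+-cancelʳ-≡ 0 _ _ (subst₂ (λ p q → 1 * count (X₁ X c) + q ≡ 1 * count (X₀ X c) + p)
        (m+n≡0⇒m≡0 _ e) (m+n≡0⇒n≡0 (pairs P (X₁ X c) (X̄ X c)) e) (balance X c P-sym r (λ u v f → col u v (P-⊆ u v f)))))
  ... | yes a≡b = subst (3 ≤_) (sym (cut-decompose T X))
          (arith (even pm₁) (even pm₂) (even pm₃)
            (others pm₁ (trans (cut-decompose T X) (+-comm (cutCount X P₁) _)))
            (others pm₂ (trans (cut-decompose T X) (trans (cong (cutCount X P₁ +_) (+-comm (cutCount X P₂) _)) (sym (+-assoc (cutCount X P₁) _ _)))))
            (others pm₃ (trans (cut-decompose T X) (sym (+-assoc (cutCount X P₁) _ _)))))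
    where
    T = three-factors G sy cub col
    open ThreeFactors T
    -- With equal colour classes in `X`, `balance` says that `P` leaves `X` equally often from both.
    even : ∀ {P} → PerfectMatching G P → ∃[ k ] cutCount X P ≡ k + k
    even {P} ((P-sym , P-⊆) , r) = pairs P (X₁ X c) (X̄ X c) , trans (cut-split X c P) (cong (pairs P (X₁ X c) (X̄ X c) +_)
      (+-cancelˡ-≡ (1 * count (X₁ X c)) _ _ (trans (balance X c P-sym r (λ u v f → col u v (P-⊆ u v f)))
        (cong (λ k → 1 * k + pairs P (X₁ X c) (X̄ X c)) (sym a≡b)))))
    -- Here `s` is the share of the other two matchings. Together they form the 2-factor
    -- complementary to `P`, which is connected and hence crosses the cut.
    others : ∀ {P s} → PerfectMatching G P → cutCount X G ≡ s + cutCount X P → 1 ≤ s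
    others {P} {s} pm@(sp , _) e = subst (1 ≤_) (+-cancelʳ-≡ (cutCount X P) _ _ (trans (sym (cut-─ sp X)) e))
      (connected⇒crossing (2fc (G ─ P) (complement-twoFactor sy cub pm)) X xu xv)
    double : ∀ k → 2 ≤ suc k + suc k
    double k = +-mono-≤ {1} {suc k} {1} {suc k} (s≤s z≤n) (s≤s z≤n)
    arith : ∀ {s t r} → ∃[ k ] s ≡ k + k → ∃[ k ] t ≡ k + k → ∃[ k ] r ≡ k + k →
            1 ≤ t + r → 1 ≤ s + r → 1 ≤ s + t → 3 ≤ s + (t + r)
    arith (zero , refl) (zero , refl) _ _ _ ()
    arith (zero , refl) (suc k , refl) (zero , refl) _ () _
    arith (zero , refl) (suc k , refl) (suc l , refl) _ _ _ =
      ≤-trans (m≤m+n 3 1) (+-mono-≤ (double k) (double l))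
    arith (suc k , refl) _ _ p _ _ = +-mono-≤ (double k) p

  -- If `u` had two edges across, moving it to the other shore would lose at least two cut edges and
  -- gain at most one. The new shore `Y` is nonempty because `X` has a second vertex, so this
  -- contradicts `cut≥3`.
  three-cut⇒matching : ∀ X → cutCount X G ≡ 3 → 2 ≤ count X →
                       ∀ u → X u ≡ true → count (λ v → not (X v) ∧ G u v) ≤ 1
  three-cut⇒matching X cut big u xu with count (λ v → not (X v) ∧ G u v) ≤? 1
  ... | yes p = p
  ... | no ¬p = contradiction (subst (3 ≤_) cutY (cut≥3 Y yw yu)) (<⇒≱ small)
    where
    one Y : Fin n → Bool
    one v = does (v ≟ u)
    Y v = X v ∧ not (one v)

    one-u : one u ≡ true
    one-u = dec-true (u ≟ u) refl

    yu : Y u ≡ false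
    yu = trans (cong (λ b → X u ∧ not b) one-u) (Bool.∧-zeroʳ (X u))

    in-Y : ∀ {w} → w ≢ u → X w ≡ true → Y w ≡ true
    in-Y {w} ne xw = ∧-intro xw (cong not (dec-false (w ≟ u) ne))

    other : ∃[ w ] Y w ≡ true
    other with a , b , ne , xa , xb ← count-two⁻¹ X big with a ≟ u
    ... | no a≢u   = a , in-Y a≢u xa
    ... | yes refl = b , in-Y (ne ∘ sym) xb
    yw = proj₂ other

    X≡Y+one : ∀ v → bit (X v) ≡ bit (Y v) + bit (one v)
    X≡Y+one v with v ≟ u
    ... | yes refl rewrite xu = refl
    ... | no _ = trans (cong bit (sym (Bool.∧-identityʳ (X v)))) (sym (+-identityʳ _))

    Ȳ≡X̄+one : ∀ v → bit (not (Y v)) ≡ bit (not (X v)) + bit (one v)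
    Ȳ≡X̄+one v with v ≟ u
    ... | yes refl rewrite xu = refl
    ... | no _ = trans (cong (bit ∘ not) (Bool.∧-identityʳ (X v))) (sym (+-identityʳ _))

    s o i : ℕ
    s = pairs G Y (not ∘ X)
    o = pairs G one (not ∘ X)
    i = pairs G one X

    s+o : s + o ≡ 3
    s+o = trans (sym (pairs-splitˡ G X Y one (not ∘ X) X≡Y+one)) (trans (sym (cutCount≡pairs X G)) cut)

    count-one : count one ≡ 1
    count-one = count-single one one-u (λ b → does-true (b ≟ u))

    i+o : i + o ≡ 3
    i+o = trans (sym (pairs-splitʳ G one all X (not ∘ X) (bit-not ∘ X)))
                (trans (pairs-regular G one cub) (cong (3 *_) count-one))

    2≤o : 2 ≤ o
    2≤o = ≤-trans (≰⇒> ¬p) (≤-trans (≤-reflexive (trans (sym (+-identityʳ _)) (cong (λ b → bit b * count (λ v → not (X v) ∧ G u v)) (sym one-u))))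
      (subst (bit (one u) * count (λ v → not (X v) ∧ G u v) ≤_) (sym (pairs-rows G one (not ∘ X)))
        (sum-term (λ w → bit (one w) * count (λ v → not (X v) ∧ G w v)) u)))

    cutY : cutCount Y G ≡ s + pairs G Y one
    cutY = trans (cutCount≡pairs Y G) (pairs-splitʳ G Y (not ∘ Y) (not ∘ X) one Ȳ≡X̄+one)

    back≤i : pairs G Y one ≤ i
    back≤i = ≤-trans (≤-reflexive (pairs-sym sy Y one)) (pairs-mono G one one Y X (λ a b p q _ → p , proj₁ (∧-true q)))

    ≤1 : ∀ {k} → k + o ≡ 3 → k ≤ 1
    ≤1 {k} e = +-cancelʳ-≤ 2 k 1 (≤-trans (+-monoʳ-≤ k 2≤o) (≤-reflexive e))

    small : s + pairs G Y one < 3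
    small = s≤s (+-mono-≤ (≤1 s+o) (≤-trans back≤i (≤1 i+o)))

-- Contracting the two sides of a cut

-- A cut given as a bijection onto a disjoint sum: each shore has its own index set, as contractions
-- and star products require.
Split : ℕ → ℕ → ℕ → Set
Split n m₁ m₂ = Fin n ↔ (Fin m₁ ⊎ Fin m₂)

swap : ∀ {n m₁ m₂} → Split n m₁ m₂ → Split n m₂ m₁
swap {m₁ = m₁} {m₂} s = mk↔ₛ′ (Sum.swap ∘ to) (from ∘ Sum.swap)
  (λ { (inj₁ b) → cong Sum.swap (strictlyInverseˡ (inj₂ b)) ; (inj₂ a) → cong Sum.swap (strictlyInverseˡ (inj₁ a)) })
  (λ u → trans (cong from (swap-involutive (to u))) (strictlyInverseʳ u))
  where open Inverse s

split-cons : ∀ {n m₁ m₂} → Split n m₁ m₂ → Split (suc n) (suc m₁) m₂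
split-cons {n} {m₁} {m₂} s = mk↔ₛ′ to′ from′ to∘from from∘to
  where
  open Inverse s
  to′ : Fin (suc n) → Fin (suc m₁) ⊎ Fin m₂
  to′ zero    = inj₁ zero
  to′ (suc u) = Sum.map₁ suc (to u)
  from′ : Fin (suc m₁) ⊎ Fin m₂ → Fin (suc n)
  from′ (inj₁ zero)    = zero
  from′ (inj₁ (suc a)) = suc (from (inj₁ a))
  from′ (inj₂ b)       = suc (from (inj₂ b))
  to∘from : ∀ x → to′ (from′ x) ≡ x
  to∘from (inj₁ zero)    = refl
  to∘from (inj₁ (suc a)) = cong (Sum.map₁ suc) (strictlyInverseˡ (inj₁ a))
  to∘from (inj₂ b)       = cong (Sum.map₁ suc) (strictlyInverseˡ (inj₂ b))
  from-suc : ∀ x → from′ (Sum.map₁ suc x) ≡ suc (from x)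
  from-suc (inj₁ a) = refl
  from-suc (inj₂ b) = refl
  from∘to : ∀ u → from′ (to′ u) ≡ u
  from∘to zero    = refl
  from∘to (suc u) = trans (from-suc (to u)) (cong suc (strictlyInverseʳ u))

module _ {n m₁ m₂ : ℕ} (s : Split n m₁ m₂) where
  open Inverse s

  e₁ : Fin m₁ → Fin n
  e₁ = from ∘ inj₁

  e₂ : Fin m₂ → Fin n
  e₂ = from ∘ inj₂

  side : Fin n → Bool
  side u = Sum.[ (λ _ → true) , (λ _ → false) ] (to u)

  side-e₁ : ∀ a → side (e₁ a) ≡ true
  side-e₁ a = cong Sum.[ (λ _ → true) , (λ _ → false) ] (strictlyInverseˡ (inj₁ a))

  side-e₂ : ∀ b → side (e₂ b) ≡ false
  side-e₂ b = cong Sum.[ (λ _ → true) , (λ _ → false) ] (strictlyInverseˡ (inj₂ b))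

  sum-split : ∀ (h : Fin n → ℕ) → sumFin h ≡ sumFin (h ∘ e₁) + sumFin (h ∘ e₂)
  sum-split h = trans (sum-permute h (↔-sym s ↔-∘ +↔⊎)) (trans (sum-join m₁ {m₂} (λ i → h (from (splitAt m₁ i))))
    (cong₂ _+_ (sum-cong λ a → cong (h ∘ from) (splitAt-↑ˡ m₁ a m₂))
               (sum-cong λ b → cong (h ∘ from) (splitAt-↑ʳ m₁ m₂ b))))

  count-split : ∀ (f : Fin n → Bool) → count f ≡ count (f ∘ e₁) + count (f ∘ e₂)
  count-split f = trans (count≡sum f) (trans (sum-split (bit ∘ f))
    (sym (cong₂ _+_ (count≡sum (f ∘ e₁)) (count≡sum (f ∘ e₂)))))

  crossing : Graph n → ℕ
  crossing P = sumFin λ a → count λ b → P (e₁ a) (e₂ b)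

  module _ {X : Fin n → Bool} (X-e₁ : ∀ a → X (e₁ a) ≡ true) (X-e₂ : ∀ b → X (e₂ b) ≡ false) where

    count-out : ∀ (f : Fin n → Bool) → count (λ v → not (X v) ∧ f v) ≡ count (f ∘ e₂)
    count-out f = trans (count-split (λ v → not (X v) ∧ f v)) (cong₂ _+_
      (count-none _ λ a → cong (λ x → not x ∧ f (e₁ a)) (X-e₁ a))
      (count-cong λ b → cong (λ x → not x ∧ f (e₂ b)) (X-e₂ b)))

    cut≡crossing : ∀ P → cutCount X P ≡ crossing P
    cut≡crossing P = trans (sum-split (λ u → if X u then count (λ v → not (X v) ∧ P u v) else 0))
      (trans (cong₂ _+_ (sum-cong λ a → trans (cong (λ x → if x then count (λ v → not (X v) ∧ P (e₁ a) v) else 0) (X-e₁ a)) (count-out (P (e₁ a))))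
                        (sum-0 _ λ b → cong (λ x → if x then count (λ v → not (X v) ∧ P (e₂ b) v) else 0) (X-e₂ b)))
             (+-identityʳ _))

    count-inside : count X ≡ m₁
    count-inside = trans (count-split X) (trans (cong₂ _+_
      (trans (count-cong X-e₁) (trans (count≡sum {m₁} (λ _ → true)) (sum-1 m₁)))
      (count-none _ X-e₂)) (+-identityʳ m₁))

    count-outside : count (not ∘ X) ≡ m₂
    count-outside = trans (count-split (not ∘ X)) (cong₂ _+_ (count-none _ (cong not ∘ X-e₁))
      (trans (count-cong (cong not ∘ X-e₂)) (trans (count≡sum {m₂} (λ _ → true)) (sum-1 m₂))))

crossing-swap : ∀ {n m₁ m₂} (s : Split n m₁ m₂) {G} → Symmetric G → crossing (swap s) G ≡ crossing s G
crossing-swap s {G} sy = begin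
  sumFin (λ b → count λ a → G (e₂ s b) (e₁ s a))        ≡⟨ sum-cong (λ b → count≡sum λ a → G (e₂ s b) (e₁ s a)) ⟩
  sumFin (λ b → sumFin λ a → bit (G (e₂ s b) (e₁ s a))) ≡⟨ sum-swap (λ b a → bit (G (e₂ s b) (e₁ s a))) ⟩
  sumFin (λ a → sumFin λ b → bit (G (e₂ s b) (e₁ s a))) ≡⟨ sum-cong (λ a → sum-cong λ b → cong bit (sy (e₂ s b) (e₁ s a))) ⟩
  sumFin (λ a → sumFin λ b → bit (G (e₁ s a) (e₂ s b))) ≡⟨ sum-cong (λ a → count≡sum λ b → G (e₁ s a) (e₂ s b)) ⟨
  sumFin (λ a → count λ b → G (e₁ s a) (e₂ s b))        ∎
  where open ≡-Reasoning

partition : ∀ {n} (X : Fin n → Bool) → ∃[ m₁ ] ∃[ m₂ ] Σ (Split n m₁ m₂) λ s →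
            (∀ a → X (e₁ s a) ≡ true) × (∀ b → X (e₂ s b) ≡ false)
partition {zero} X = 0 , 0 , mk↔ₛ′ (λ ()) Sum.[ (λ ()) , (λ ()) ] (λ { (inj₁ ()) ; (inj₂ ()) }) (λ ()) , (λ ()) , (λ ())
partition {suc n} X with m₁ , m₂ , s , p₁ , p₂ ← partition (X ∘ suc) with X zero in x₀
... | true  = suc m₁ , m₂ , split-cons s , (λ { zero → x₀ ; (suc a) → p₁ a }) , p₂
... | false = m₁ , suc m₂ , swap (split-cons (swap s)) , p₁ , (λ { zero → x₀ ; (suc b) → p₂ b })

-- Star products are not braces

constructible-irreflexive : ∀ {n G} → Constructible n G → ∀ u → G u u ≡ false
constructible-irreflexive k33     = toWitness {a? = all? (λ u → K33 u u Bool.≟ false)} _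
constructible-irreflexive heawood = toWitness {a? = all? (λ u → Heawood u u Bool.≟ false)} _
constructible-irreflexive (star {m₁} v₁ v₂ M C₁ C₂ _ _ _) u with splitAt m₁ u
... | inj₁ a = constructible-irreflexive C₁ (punchIn v₁ a)
... | inj₂ b = constructible-irreflexive C₂ (punchIn v₂ b)

-- Row `a` of `M` holds one edge exactly if `a` is a neighbour of `v₁`, so the total is the degree
-- of `v₁`. A loop at `v₁` would account for one of the three and leave only two joining edges.
star-edge-count : ∀ {m₁ m₂} {G₁ : Graph (suc m₁)} {v₁} {G₂ : Graph (suc m₂)} {v₂ M} →
        deg G₁ v₁ ≡ 3 → G₁ v₁ v₁ ≡ false → StarMatching G₁ v₁ G₂ v₂ M →
        sumFin (λ a → count (M a)) ≡ 3
star-edge-count {G₁ = G₁} {v₁} {M = M} d irr (M-ends , M-row , _) = begin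
  sumFin (λ a → count (M a))                         ≡⟨ sum-cong row ⟩
  sumFin (λ a → bit (G₁ v₁ (punchIn v₁ a)))          ≡⟨ cong (λ x → bit x + sumFin (λ a → bit (G₁ v₁ (punchIn v₁ a)))) irr ⟨
  bit (G₁ v₁ v₁) + sumFin (λ a → bit (G₁ v₁ (punchIn v₁ a))) ≡⟨ sum-punchIn (bit ∘ G₁ v₁) v₁ ⟨
  sumFin (bit ∘ G₁ v₁)                               ≡⟨ count≡sum (G₁ v₁) ⟨
  deg G₁ v₁                                          ≡⟨ d ⟩
  3                                                  ∎
  where
  open ≡-Reasoning
  row : ∀ a → count (M a) ≡ bit (G₁ v₁ (punchIn v₁ a))
  row a with G₁ v₁ (punchIn v₁ a) in e
  ... | true  = M-row a e
  ... | false = count-none (M a) λ b → Bool.¬-not λ m → true≢false (proj₁ (M-ends a b m)) e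

star-not-brace : ∀ {n} {G : Graph n} {m₁ m₂} {G₁ : Graph (suc m₁)} {v₁} {G₂ : Graph (suc m₂)} {v₂ M} →
  IsSimple G → Cubic G → Brace G → G ≅ starProduct G₁ v₁ G₂ v₂ M →
  deg G₁ v₁ ≡ 3 → deg G₂ v₂ ≡ 3 → StarMatching G₁ v₁ G₂ v₂ M → ¬ (G₁ v₁ v₁ ≡ false)
star-not-brace {n} {G} {m₁} {m₂} {G₁} {v₁} {G₂} {v₂} {M} (sy , _) cub ((c , col) , _ , tight-trivial) (f , iso) d₁ d₂ SM irr =
  nontrivial (tight-trivial X (three-cut⇒tight sy cub col X cut))
  where
  s : Split n m₁ m₂
  s = +↔⊎ ↔-∘ ⤖⇒↔ f

  X : Fin n → Bool
  X = side s

  G≡M : ∀ a b → G (e₁ s a) (e₂ s b) ≡ M a b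
  G≡M a b = trans (iso (e₁ s a) (e₂ s b))
    (cong₂ (crossAdj G₁ v₁ G₂ v₂ M) (Inverse.strictlyInverseˡ s (inj₁ a)) (Inverse.strictlyInverseˡ s (inj₂ b)))

  cut : cutCount X G ≡ 3
  cut = trans (cut≡crossing s (side-e₁ s) (side-e₂ s) G)
    (trans (sum-cong λ a → count-cong λ b → G≡M a b) (star-edge-count {G₁ = G₁} {G₂ = G₂} {M = M} d₁ irr SM))

  -- A shore with one vertex would come from a factor on two vertices, too small for degree 3.
  large : ∀ {m} {H : Graph (suc m)} {v} → deg H v ≡ 3 → m ≢ 1
  large {H = H} {v} d refl with s≤s (s≤s ()) ← subst (_≤ 2) d (count≤n (H v))

  nontrivial : ¬ TrivialCut X
  nontrivial (inj₁ e) = large {H = G₁} d₁ (trans (sym (count-inside s (side-e₁ s) (side-e₂ s))) e)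
  nontrivial (inj₂ e) = large {H = G₂} d₂ (trans (sym (count-outside s (side-e₁ s) (side-e₂ s))) e)

1⇒2 : Statement1 → Statement2
1⇒2 st1 n G simple cub brace@(bip , _) tfh with st1 n G simple cub bip tfh
... | H , k33     , iso = inj₁ iso
... | H , heawood , iso = inj₂ iso
... | H , star {G₁ = G₁} {G₂} v₁ v₂ M C₁ C₂ d₁ d₂ SM , iso = contradiction (constructible-irreflexive C₁ v₁)
        (star-not-brace {G₁ = G₁} {G₂ = G₂} simple cub brace iso d₁ d₂ SM)

-- Contraction of one shore

module _ {n m₁ m₂ : ℕ} (s : Split n m₁ m₂) (G : Graph n) where

  cross : Fin m₁ → Bool
  cross a = does (1 ≤? count (λ b → G (e₁ s a) (e₂ s b)))

  -- The vertex `zero` is the second shore shrunk to a point. Boolean adjacency forgets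
  -- multiplicities, so degrees are preserved only when each vertex sends at most one edge across;
  -- this is the condition `rows`.
  contract : Graph (suc m₁)
  contract zero    zero    = false
  contract zero    (suc a) = cross a
  contract (suc a) zero    = cross a
  contract (suc a) (suc b) = G (e₁ s a) (e₁ s b)

  cross-intro : ∀ {a b} → G (e₁ s a) (e₂ s b) ≡ true → cross a ≡ true
  cross-intro {a} {b} e = dec-true (1 ≤? _) (count-pos (λ b → G (e₁ s a) (e₂ s b)) {b} e)

  cross-elim : ∀ {a} → cross a ≡ true → ∃[ b ] G (e₁ s a) (e₂ s b) ≡ true
  cross-elim {a} e = count-pos⁻¹ (λ b → G (e₁ s a) (e₂ s b)) (does-true (1 ≤? _) e)

  contract-simple : IsSimple G → IsSimple contract
  contract-simple (sy , irr) = sym′ , irr′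
    where
    sym′ : Symmetric contract
    sym′ zero    zero    = refl
    sym′ zero    (suc a) = refl
    sym′ (suc a) zero    = refl
    sym′ (suc a) (suc b) = sy (e₁ s a) (e₁ s b)
    irr′ : ∀ x → contract x x ≡ false
    irr′ zero    = refl
    irr′ (suc a) = irr (e₁ s a)

  contract-colour : Bool → (Fin n → Bool) → Fin (suc m₁) → Bool
  contract-colour κ c zero    = not κ
  contract-colour κ c (suc a) = c (e₁ s a)

  contract-proper : ∀ {c} κ → ProperColouring G c → (∀ a → cross a ≡ true → c (e₁ s a) ≡ κ) →
                    ProperColouring contract (contract-colour κ c)
  contract-proper κ col h zero    (suc a) e = λ q → Bool.not-¬ refl (trans (sym (h a e)) (sym q))
  contract-proper κ col h (suc a) zero    e = λ q → Bool.not-¬ refl (trans (sym (h a e)) q)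
  contract-proper κ col h (suc a) (suc b) e = col (e₁ s a) (e₁ s b) e

  module _ (rows : ∀ a → count (λ b → G (e₁ s a) (e₂ s b)) ≤ 1) where

    bit-cross : ∀ a → bit (cross a) ≡ count (λ b → G (e₁ s a) (e₂ s b))
    bit-cross a = aux (rows a)
      where
      aux : ∀ {k} → k ≤ 1 → bit (does (1 ≤? k)) ≡ k
      aux z≤n       = refl
      aux (s≤s z≤n) = refl

    count-cross : crossing s G ≡ 3 → count cross ≡ 3
    count-cross total = trans (count≡sum cross) (trans (sum-cong bit-cross) total)

    contract-cubic : Cubic G → crossing s G ≡ 3 → Cubic contract
    contract-cubic cub total zero    = count-cross total
    contract-cubic cub total (suc a) = trans (cong (_+ count (λ b → G (e₁ s a) (e₁ s b))) (bit-cross a))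
      (trans (+-comm (count (λ b → G (e₁ s a) (e₂ s b))) _) (trans (sym (count-split s (G (e₁ s a)))) (cub (e₁ s a))))

-- The cut edges leave the first shore from one colour class only, so the contracted vertex can be
-- given the opposite colour.
cross-colour : ∀ {n m₁ m₂} (s : Split n m₁ m₂) {G : Graph n} {c} → Symmetric G → Cubic G → ProperColouring G c →
               crossing s G ≡ 3 → ∃[ κ ] (∀ a → cross s G a ≡ true → c (e₁ s a) ≡ κ)
cross-colour s {G} {c} sy cub col total =
  aux (three-cut-oneSided sy cub col X (trans (cut≡crossing s (side-e₁ s) (side-e₂ s) G) total))
  where
  X = side s
  aux : OneSided (count (X₁ X c)) (count (X₀ X c)) (pairs G (X₁ X c) (X̄ X c)) (pairs G (X₀ X c) (X̄ X c)) →
        ∃[ κ ] (∀ a → cross s G a ≡ true → c (e₁ s a) ≡ κ)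
  aux (left _ _ none) = true , λ a cr → Bool.¬-not λ ca → let b , g = cross-elim s G cr in
    contradiction (subst (1 ≤_) none (pairs-term G {X₀ X c} {X̄ X c} {e₁ s a} {e₂ s b}
      (∧-intro (side-e₁ s a) (cong not ca)) (cong not (side-e₂ s b)) g)) λ ()
  aux (right _ none _) = false , λ a cr → Bool.¬-not λ ca → let b , g = cross-elim s G cr in
    contradiction (subst (1 ≤_) none (pairs-term G {X₁ X c} {X̄ X c} {e₁ s a} {e₂ s b}
      (∧-intro (side-e₁ s a) ca) (cong not (side-e₂ s b)) g)) λ ()

-- Gluing 2-factors of the two contractions

module _ {n m₁ m₂ : ℕ} (s : Split n m₁ m₂) {G : Graph n} (sy : Symmetric G)
         (rows : ∀ a → count (λ b → G (e₁ s a) (e₂ s b)) ≤ 1)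
         (cols : ∀ b → count (λ a → G (e₂ s b) (e₁ s a)) ≤ 1)
         {F₁ : Graph (suc m₁)} {F₂ : Graph (suc m₂)}
         (tf₁ : TwoFactor (contract s G) F₁) (tf₂ : TwoFactor (contract (swap s) G) F₂)
         (agree : ∀ a b → G (e₁ s a) (e₂ s b) ≡ true → F₁ zero (suc a) ≡ F₂ zero (suc b)) where

  open Inverse s using (to; from; strictlyInverseˡ; strictlyInverseʳ)

  -- A cut edge is kept when `F₁` uses its image at `zero`; by `agree` the same rule results from
  -- `F₂`. Each vertex thus exchanges its edge to `zero`, if any, for its unique cut edge.
  glued-M : Fin m₁ → Fin m₂ → Bool
  glued-M a b = G (e₁ s a) (e₂ s b) ∧ F₁ zero (suc a)

  glued⊎ : Fin m₁ ⊎ Fin m₂ → Fin m₁ ⊎ Fin m₂ → Bool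
  glued⊎ = crossAdj F₁ zero F₂ zero glued-M

  glued : Graph n
  glued u v = glued⊎ (to u) (to v)

  glued⊎-sym : ∀ x y → glued⊎ x y ≡ glued⊎ y x
  glued⊎-sym (inj₁ a) (inj₁ b) = proj₁ (proj₁ tf₁) (suc a) (suc b)
  glued⊎-sym (inj₁ a) (inj₂ b) = refl
  glued⊎-sym (inj₂ a) (inj₁ b) = refl
  glued⊎-sym (inj₂ a) (inj₂ b) = proj₁ (proj₁ tf₂) (suc a) (suc b)

  glued⊎-⊆ : ∀ x y → glued⊎ x y ≡ true → G (from x) (from y) ≡ true
  glued⊎-⊆ (inj₁ a) (inj₁ b) e = proj₂ (proj₁ tf₁) (suc a) (suc b) e
  glued⊎-⊆ (inj₁ a) (inj₂ b) e = proj₁ (∧-true e)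
  glued⊎-⊆ (inj₂ a) (inj₁ b) e = trans (sy _ _) (proj₁ (∧-true e))
  glued⊎-⊆ (inj₂ a) (inj₂ b) e = proj₂ (proj₁ tf₂) (suc a) (suc b) e

  count-∧ : ∀ {k} (f : Fin k → Bool) φ → (φ ≡ true → count f ≡ 1) → count (λ b → f b ∧ φ) ≡ bit φ
  count-∧ f true  h = trans (count-cong (λ b → Bool.∧-identityʳ (f b))) (h refl)
  count-∧ f false h = count-none _ (λ b → Bool.∧-zeroʳ (f b))

  glued⊎-deg : ∀ x → count (glued⊎ x ∘ inj₁) + count (glued⊎ x ∘ inj₂) ≡ 2
  glued⊎-deg (inj₁ a) = begin
    count (F₁ (suc a) ∘ suc) + count (glued-M a)
      ≡⟨ cong (count (F₁ (suc a) ∘ suc) +_) (count-∧ (λ b → G (e₁ s a) (e₂ s b)) (F₁ zero (suc a))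
           (λ f → trans (sym (bit-cross s G rows a)) (cong bit (proj₂ (proj₁ tf₁) zero (suc a) f)))) ⟩
    count (F₁ (suc a) ∘ suc) + bit (F₁ zero (suc a))
      ≡⟨ +-comm (count (F₁ (suc a) ∘ suc)) _ ⟩
    bit (F₁ zero (suc a)) + count (F₁ (suc a) ∘ suc)
      ≡⟨ cong (λ x → bit x + count (F₁ (suc a) ∘ suc)) (proj₁ (proj₁ tf₁) zero (suc a)) ⟩
    deg F₁ (suc a)
      ≡⟨ proj₂ tf₁ (suc a) ⟩
    2 ∎
    where open ≡-Reasoning
  glued⊎-deg (inj₂ b) = begin
    count (λ a → glued-M a b) + count (F₂ (suc b) ∘ suc)
      ≡⟨ cong (_+ count (F₂ (suc b) ∘ suc)) (count-cong (λ a → flip a)) ⟩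
    count (λ a → G (e₂ s b) (e₁ s a) ∧ F₂ zero (suc b)) + count (F₂ (suc b) ∘ suc)
      ≡⟨ cong (_+ count (F₂ (suc b) ∘ suc)) (count-∧ (λ a → G (e₂ s b) (e₁ s a)) (F₂ zero (suc b))
           (λ f → trans (sym (bit-cross (swap s) G cols b)) (cong bit (proj₂ (proj₁ tf₂) zero (suc b) f)))) ⟩
    bit (F₂ zero (suc b)) + count (F₂ (suc b) ∘ suc)
      ≡⟨ cong (λ x → bit x + count (F₂ (suc b) ∘ suc)) (proj₁ (proj₁ tf₂) zero (suc b)) ⟩
    deg F₂ (suc b)
      ≡⟨ proj₂ tf₂ (suc b) ⟩
    2 ∎
    where
    open ≡-Reasoning
    flip : ∀ a → glued-M a b ≡ G (e₂ s b) (e₁ s a) ∧ F₂ zero (suc b)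
    flip a = trans (aux (agree a b)) (cong (_∧ F₂ zero (suc b)) (sy (e₁ s a) (e₂ s b)))
      where
      aux : ∀ {g x y} → (g ≡ true → x ≡ y) → g ∧ x ≡ g ∧ y
      aux {true}  h = h refl
      aux {false} h = refl

  glued-twoFactor : TwoFactor G glued
  glued-twoFactor = ((λ u v → glued⊎-sym (to u) (to v)) , sub) , degree
    where
    sub : ∀ u v → glued u v ≡ true → G u v ≡ true
    sub u v e = subst₂ (λ x y → G x y ≡ true) (strictlyInverseʳ u) (strictlyInverseʳ v) (glued⊎-⊆ (to u) (to v) e)
    degree : ∀ u → deg glued u ≡ 2
    degree u = trans (count-split s (glued u)) (trans (cong₂ _+_
      (count-cong λ a → cong (glued⊎ (to u)) (strictlyInverseˡ (inj₁ a)))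
      (count-cong λ b → cong (glued⊎ (to u)) (strictlyInverseˡ (inj₂ b)))) (glued⊎-deg (to u)))

  collapse⊎ : Fin m₁ ⊎ Fin m₂ → Fin (suc m₁)
  collapse⊎ = Sum.[ suc , (λ _ → zero) ]

  collapse-edge : ∀ x y → glued⊎ x y ≡ true → Reach F₁ (collapse⊎ x) (collapse⊎ y)
  collapse-edge (inj₁ a) (inj₁ b) e = step e here
  collapse-edge (inj₁ a) (inj₂ b) e = step (trans (proj₁ (proj₁ tf₁) (suc a) zero) (proj₂ (∧-true e))) here
  collapse-edge (inj₂ b) (inj₁ a) e = step (proj₂ (∧-true e)) here
  collapse-edge (inj₂ b) (inj₂ a) e = here

  -- Shrinking the second shore sends every glued edge to an edge of `F₁` or to a point. The vertex
  -- `b` serves as a preimage of `zero`.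
  glued-connected⇒ : Fin m₂ → Connected glued → Connected F₁
  glued-connected⇒ b conn x y = subst₂ (Reach F₁) (collapse-lift x) (collapse-lift y)
    (reach-map (collapse⊎ ∘ to) (λ u v → collapse-edge (to u) (to v)) (conn (lift x) (lift y)))
    where
    lift : Fin (suc m₁) → Fin n
    lift zero    = e₂ s b
    lift (suc a) = e₁ s a
    collapse-lift : ∀ x → collapse⊎ (to (lift x)) ≡ x
    collapse-lift zero    = cong collapse⊎ (strictlyInverseˡ (inj₂ b))
    collapse-lift (suc a) = cong collapse⊎ (strictlyInverseˡ (inj₁ a))

-- A 2-factor F₁ of the contraction misses exactly one cut edge a₀b₀; the
-- complement of a perfect matching through b₀ in the other contraction
-- misses the same cut edge, so the two can be glued.
contract-connected : ∀ {n m₁ m₂} (s : Split n m₁ m₂) {G : Graph n} → Symmetric G →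
  (∀ a → count (λ b → G (e₁ s a) (e₂ s b)) ≤ 1) → (∀ b → count (λ a → G (e₂ s b) (e₁ s a)) ≤ 1) →
  crossing s G ≡ 3 → Symmetric (contract (swap s) G) → Cubic (contract (swap s) G) → ThreeFactors (contract (swap s) G) →
  TwoFactorsConnected G → TwoFactorsConnected (contract s G)
contract-connected {n} {m₁} {m₂} s {G} sy rows cols total sy₂ cub₂ T₂ 2fc F₁ tf₁@((F₁-sym , F₁-⊆) , F₁-deg) =
  finish (count-single⁻¹ miss count-miss)
  where
  miss : Fin m₁ → Bool
  miss a = cross s G a ∧ not (F₁ zero (suc a))

  F₁-loop : F₁ zero zero ≡ false
  F₁-loop = Bool.¬-not λ e → true≢false (F₁-⊆ zero zero e) refl

  count-miss : count miss ≡ 1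
  count-miss = +-cancelʳ-≡ 2 (count miss) 1 (begin
    count miss + 2
      ≡⟨ cong (count miss +_) (F₁-deg zero) ⟨
    count miss + deg F₁ zero
      ≡⟨ cong (λ x → count miss + (bit x + count (F₁ zero ∘ suc))) F₁-loop ⟩
    count miss + count (F₁ zero ∘ suc)
      ≡⟨ count-+ {f = miss} {g = F₁ zero ∘ suc} {h = cross s G} (λ a → bit-difference (F₁-⊆ zero (suc a))) ⟨
    count (cross s G)
      ≡⟨ count-cross s G rows total ⟩
    3 ∎)
    where open ≡-Reasoning

  finish : ∃[ a₀ ] (miss a₀ ≡ true × (∀ a → miss a ≡ true → a ≡ a₀)) → Connected F₁
  finish (a₀ , miss₀ , unique) = with-b₀ (cross-elim s G (proj₁ (∧-true miss₀)))
    where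
    F₁a₀ : F₁ zero (suc a₀) ≢ true
    F₁a₀ e = true⇒not≢true e (proj₂ (∧-true {cross s G a₀} miss₀))

    with-b₀ : ∃[ b ] G (e₁ s a₀) (e₂ s b) ≡ true → Connected F₁
    with-b₀ (b₀ , g₀) = with-P (edge-in-matching T₂ zero (suc b₀)
        (cross-intro (swap s) G {b₀} {a₀} (trans (sy (e₂ s b₀) (e₁ s a₀)) g₀)))
      where
      with-P : Σ (Graph (suc m₂)) (λ P → PerfectMatching (contract (swap s) G) P × P zero (suc b₀) ≡ true) → Connected F₁
      with-P (P , pm , p₀) = glued-connected⇒ s sy rows cols tf₁ tf₂ agree b₀
        (2fc (glued s sy rows cols tf₁ tf₂ agree) (glued-twoFactor s sy rows cols tf₁ tf₂ agree))
        where
        tf₂ : TwoFactor (contract (swap s) G) (contract (swap s) G ─ P)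
        tf₂ = complement-twoFactor sy₂ cub₂ pm

        -- `F₁` omits the cut edge at `a` only if `a` is `a₀`, and the other 2-factor omits the one
        -- at `b` only if `b` is `b₀`. As the cut is a matching, an edge between `a` and `b` makes
        -- the two conditions equivalent.
        agree : ∀ a b → G (e₁ s a) (e₂ s b) ≡ true → F₁ zero (suc a) ≡ (contract (swap s) G ─ P) zero (suc b)
        agree a b g = ⇔⇒≡ forth back
          where
          g′ : G (e₂ s b) (e₁ s a) ≡ true
          g′ = trans (sy _ _) g
          forth : F₁ zero (suc a) ≡ true → (contract (swap s) G ─ P) zero (suc b) ≡ true
          forth f = ∧-intro (cross-intro (swap s) G {b} {a} g′) (cong not (Bool.¬-not λ p → F₁a₀ (trans (cong (F₁ zero ∘ suc) (sym (a≡a₀ p))) f)))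
            where
            a≡a₀ : P zero (suc b) ≡ true → a ≡ a₀
            a≡a₀ p with refl ← count≤1⇒unique (P zero) (≤-reflexive (proj₂ pm zero)) p p₀ =
              count≤1⇒unique (λ a → G (e₂ s b₀) (e₁ s a)) (cols b₀) g′ (trans (sy _ _) g₀)
          back : (contract (swap s) G ─ P) zero (suc b) ≡ true → F₁ zero (suc a) ≡ true
          back q = Bool.¬-not λ f → true⇒not≢true (P-b (unique a (∧-intro (cross-intro s G {a} {b} g) (cong not f))))
                     (proj₂ (∧-true {cross (swap s) G b} q))
            where
            P-b : a ≡ a₀ → P zero (suc b) ≡ true
            P-b refl = trans (cong (P zero ∘ suc) (count≤1⇒unique (λ b → G (e₁ s a₀) (e₂ s b)) (rows a₀) g g₀)) p₀

-- Recovering the graph as a star product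

ConstructibleUpTo≅ : ∀ {n} → Graph n → Set
ConstructibleUpTo≅ {n} G = Σ (Graph n) λ H → Constructible n H × (G ≅ H)

deg-≅ : ∀ {m n} {G : Graph m} {H : Graph n} ((f , _) : G ≅ H) → ∀ v → deg H (Bijection.to f v) ≡ deg G v
deg-≅ {H = H} (f , iso) v = trans (count-permute (H (Bijection.to f v)) (⤖⇒↔ f)) (sym (count-cong (iso v)))

module Reassemble {n m₁ m₂ : ℕ} (s : Split n m₁ m₂) {G : Graph n} (sy : Symmetric G)
         (rows : ∀ a → count (λ b → G (e₁ s a) (e₂ s b)) ≤ 1)
         (cols : ∀ b → count (λ a → G (e₂ s b) (e₁ s a)) ≤ 1)
         (cub₁ : Cubic (contract s G)) (cub₂ : Cubic (contract (swap s) G))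
         {H₁ : Graph (suc m₁)} {H₂ : Graph (suc m₂)}
         (con₁ : Constructible (suc m₁) H₁) (con₂ : Constructible (suc m₂) H₂)
         (iso₁ : contract s G ≅ H₁) (iso₂ : contract (swap s) G ≅ H₂) where

  π₁ : Permutation (suc m₁) (suc m₁)
  π₁ = ⤖⇒↔ (proj₁ iso₁)
  π₂ : Permutation (suc m₂) (suc m₂)
  π₂ = ⤖⇒↔ (proj₁ iso₂)

  v₁ : Fin (suc m₁)
  v₁ = π₁ ⟨$⟩ʳ zero
  v₂ : Fin (suc m₂)
  v₂ = π₂ ⟨$⟩ʳ zero

  -- The isomorphism takes `zero` to `v₁`. Deleting this pair leaves a permutation whose target is
  -- indexed through `punchIn v₁`, as in the definition of the star product.
  ρ₁ : Permutation m₁ m₁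
  ρ₁ = Perm.remove zero π₁
  ρ₂ : Permutation m₂ m₂
  ρ₂ = Perm.remove zero π₂

  M : Fin m₁ → Fin m₂ → Bool
  M a b = G (e₁ s (ρ₁ ⟨$⟩ˡ a)) (e₂ s (ρ₂ ⟨$⟩ˡ b))

  H₁-cross : ∀ a → H₁ v₁ (punchIn v₁ a) ≡ cross s G (ρ₁ ⟨$⟩ˡ a)
  H₁-cross a = trans (cong (H₁ v₁ ∘ punchIn v₁) (sym (Perm.inverseʳ ρ₁)))
    (trans (cong (H₁ v₁) (sym (Perm.punchIn-permute π₁ zero (ρ₁ ⟨$⟩ˡ a)))) (sym (proj₂ iso₁ zero (suc (ρ₁ ⟨$⟩ˡ a)))))

  H₂-cross : ∀ b → H₂ v₂ (punchIn v₂ b) ≡ cross (swap s) G (ρ₂ ⟨$⟩ˡ b)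
  H₂-cross b = trans (cong (H₂ v₂ ∘ punchIn v₂) (sym (Perm.inverseʳ ρ₂)))
    (trans (cong (H₂ v₂) (sym (Perm.punchIn-permute π₂ zero (ρ₂ ⟨$⟩ˡ b)))) (sym (proj₂ iso₂ zero (suc (ρ₂ ⟨$⟩ˡ b)))))

  M-star : StarMatching H₁ v₁ H₂ v₂ M
  M-star = ends , M-row , M-col
    where
    ends : ∀ a b → M a b ≡ true → (H₁ v₁ (punchIn v₁ a) ≡ true) × (H₂ v₂ (punchIn v₂ b) ≡ true)
    ends a b e = trans (H₁-cross a) (cross-intro s G {ρ₁ ⟨$⟩ˡ a} {ρ₂ ⟨$⟩ˡ b} e)
               , trans (H₂-cross b) (cross-intro (swap s) G {ρ₂ ⟨$⟩ˡ b} {ρ₁ ⟨$⟩ˡ a} (trans (sy _ _) e))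
    M-row : ∀ a → H₁ v₁ (punchIn v₁ a) ≡ true → count (M a) ≡ 1
    M-row a e = trans (sym (count-permute (λ b → G (e₁ s (ρ₁ ⟨$⟩ˡ a)) (e₂ s b)) (Perm.flip ρ₂)))
      (trans (sym (bit-cross s G rows (ρ₁ ⟨$⟩ˡ a))) (cong bit (trans (sym (H₁-cross a)) e)))
    M-col : ∀ b → H₂ v₂ (punchIn v₂ b) ≡ true → count (λ a → M a b) ≡ 1
    M-col b e = trans (count-cong (λ a → sy (e₁ s (ρ₁ ⟨$⟩ˡ a)) (e₂ s (ρ₂ ⟨$⟩ˡ b))))
      (trans (sym (count-permute (λ a → G (e₂ s (ρ₂ ⟨$⟩ˡ b)) (e₁ s a)) (Perm.flip ρ₁)))
      (trans (sym (bit-cross (swap s) G cols (ρ₂ ⟨$⟩ˡ b))) (cong bit (trans (sym (H₂-cross b)) e))))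

  star-constructible : Constructible (m₁ + m₂) (starProduct H₁ v₁ H₂ v₂ M)
  star-constructible = star v₁ v₂ M con₁ con₂ (trans (deg-≅ {H = H₁} iso₁ zero) (cub₁ zero))
    (trans (deg-≅ {H = H₂} iso₂ zero) (cub₂ zero)) M-star

  θ : Fin n ↔ Fin (m₁ + m₂)
  θ = ↔-sym +↔⊎ ↔-∘ ((ρ₁ ⊎-↔ ρ₂) ↔-∘ s)

  star-iso : G ≅ starProduct H₁ v₁ H₂ v₂ M
  star-iso = ↔⇒⤖ θ , λ u v → begin
    G u v
      ≡⟨ cong₂ G (Inverse.strictlyInverseʳ s u) (Inverse.strictlyInverseʳ s v) ⟨
    G (Inverse.from s (Inverse.to s u)) (Inverse.from s (Inverse.to s v))
      ≡⟨ edge (Inverse.to s u) (Inverse.to s v) ⟩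
    crossAdj H₁ v₁ H₂ v₂ M (relabel u) (relabel v)
      ≡⟨ cong₂ (crossAdj H₁ v₁ H₂ v₂ M) (splitAt-join m₁ m₂ (relabel u)) (splitAt-join m₁ m₂ (relabel v)) ⟨
    starProduct H₁ v₁ H₂ v₂ M (Inverse.to θ u) (Inverse.to θ v) ∎
    where
    open ≡-Reasoning
    relabel : Fin n → Fin m₁ ⊎ Fin m₂
    relabel u = Sum.map (ρ₁ ⟨$⟩ʳ_) (ρ₂ ⟨$⟩ʳ_) (Inverse.to s u)
    M-ρ : ∀ a b → G (e₁ s a) (e₂ s b) ≡ M (ρ₁ ⟨$⟩ʳ a) (ρ₂ ⟨$⟩ʳ b)
    M-ρ a b = cong₂ (λ a b → G (e₁ s a) (e₂ s b)) (sym (Perm.inverseˡ ρ₁)) (sym (Perm.inverseˡ ρ₂))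
    edge : ∀ x y → G (Inverse.from s x) (Inverse.from s y) ≡
           crossAdj H₁ v₁ H₂ v₂ M (Sum.map (ρ₁ ⟨$⟩ʳ_) (ρ₂ ⟨$⟩ʳ_) x) (Sum.map (ρ₁ ⟨$⟩ʳ_) (ρ₂ ⟨$⟩ʳ_) y)
    edge (inj₁ a) (inj₁ b) = trans (proj₂ iso₁ (suc a) (suc b))
      (cong₂ H₁ (Perm.punchIn-permute π₁ zero a) (Perm.punchIn-permute π₁ zero b))
    edge (inj₁ a) (inj₂ b) = M-ρ a b
    edge (inj₂ b) (inj₁ a) = trans (sy _ _) (M-ρ a b)
    edge (inj₂ a) (inj₂ b) = trans (proj₂ iso₂ (suc a) (suc b))
      (cong₂ H₂ (Perm.punchIn-permute π₂ zero a) (Perm.punchIn-permute π₂ zero b))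

  constructible : ConstructibleUpTo≅ G
  -- The star product lives on `m₁ + m₂` vertices, a number only provably equal to `n`; the
  -- bijection `θ` yields the equality.
  constructible = resize (Perm.↔⇒≡ θ) (starProduct H₁ v₁ H₂ v₂ M) star-constructible star-iso
    where
    resize : ∀ {m} → n ≡ m → (H : Graph m) → Constructible m H → G ≅ H → ConstructibleUpTo≅ G
    resize refl H con iso = H , con , iso

crossing⇒rows : ∀ {n m₁ m₂} (s : Split n m₁ m₂) {G : Graph n} {c} → Symmetric G → Cubic G → ProperColouring G c →
                TwoFactorsConnected G → 2 ≤ m₁ → crossing s G ≡ 3 →
                ∀ a → count (λ b → G (e₁ s a) (e₂ s b)) ≤ 1
crossing⇒rows s {G} sy cub col 2fc big total a =
  subst (_≤ 1) (count-out s (side-e₁ s) (side-e₂ s) (G (e₁ s a)))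
    (three-cut⇒matching sy cub col 2fc (side s)
      (trans (cut≡crossing s (side-e₁ s) (side-e₂ s) G) total)
      (subst (2 ≤_) (sym (count-inside s (side-e₁ s) (side-e₂ s))) big)
      (e₁ s a) (side-e₁ s a))

tfh⇒2fc : ∀ {n} {G : Graph n} → TwoFactorHamiltonian G → TwoFactorsConnected G
tfh⇒2fc tfh F tf@((F-sym , _) , _) = hamiltonian⇒connected F-sym (tfh F tf)

2fc⇒tfh : ∀ {n} {G : Graph n} {c} → 3 ≤ n → ProperColouring G c → TwoFactorsConnected G → TwoFactorHamiltonian G
2fc⇒tfh 3≤n col 2fc F tf@((F-sym , F-⊆) , F-deg) =
  connected⇒hamiltonian 3≤n F-sym F-deg (λ u v e → col u v (F-⊆ u v e)) (2fc F tf)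

-- Induction on the number of vertices

NontrivialThreeCut : ∀ {n} → Graph n → (Fin n → Bool) → Set
NontrivialThreeCut G X = cutCount X G ≡ 3 × 2 ≤ count X × 2 ≤ count (not ∘ X)

nontrivialThreeCut? : ∀ {n} (G : Graph n) → Dec (∃[ X ] NontrivialThreeCut G X)
nontrivialThreeCut? G with anySubset? (λ p → (cutCount (lookup p) G ℕ.≟ 3)
                             ×-dec (2 ≤? count (lookup p)) ×-dec (2 ≤? count (not ∘ lookup p)))
... | yes (p , cut) = yes (lookup p , cut)
... | no none = no λ { (X , cut , in≥2 , out≥2) → none (tabulate X ,
        trans (cutCount-cong (lookup∘tabulate X)) cut ,
        subst (2 ≤_) (sym (count-cong (lookup∘tabulate X))) in≥2 ,
        subst (2 ≤_) (sym (count-cong (cong not ∘ lookup∘tabulate X))) out≥2) }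
  where
  cutCount-cong : ∀ {X Y} → (∀ u → X u ≡ Y u) → cutCount X G ≡ cutCount Y G
  cutCount-cong {X} {Y} e = sum-cong λ u → cong₂ (λ x k → if x then k else 0) (e u)
    (count-cong λ v → cong (λ x → not x ∧ G u v) (e v))

-- `G` is connected because a spanning 2-factor of it is. A tight cut has three edges, so neither
-- shore is empty, and the absence of nontrivial 3-cuts leaves a shore with a single vertex.
no-three-cut⇒brace : ∀ {n} {G : Graph n} {c} → IsSimple G → Cubic G → ProperColouring G c → ThreeFactors G →
                     TwoFactorsConnected G → ¬ (∃[ X ] NontrivialThreeCut G X) → Brace G
no-three-cut⇒brace {n} {G} {c} (sy , _) cub col T 2fc none =
  (c , col) , (connected , edge-in-matching T) , trivial
  where
  open ThreeFactors T

  connected : Connected G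
  connected u v = reach-⊆ (proj₂ (proj₁ tf)) (2fc (G ─ P₁) tf u v)
    where tf = complement-twoFactor sy cub pm₁

  trivial : ∀ X → TightCut G X → TrivialCut X
  trivial X tight = cases (count X) (count (not ∘ X)) refl refl
    where
    cut : cutCount X G ≡ 3
    cut = tight⇒three-cut T X tight
    pairs≡3 : pairs G X (not ∘ X) ≡ 3
    pairs≡3 = trans (sym (cutCount≡pairs X G)) cut
    empty : ∀ {f : Fin n → Bool} → count f ≡ 0 → ∀ u → f u ≢ true
    empty {f} e u p = contradiction (subst (1 ≤_) e (count-pos f p)) λ ()
    cases : ∀ i o → count X ≡ i → count (not ∘ X) ≡ o → TrivialCut X
    cases 0 o ei eo = contradiction (trans (sym (pairs-none G {X} {not ∘ X} λ u v x _ → contradiction x (empty {X} ei u))) pairs≡3) λ ()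
    cases 1 o ei eo = inj₁ ei
    cases (suc (suc i)) 0 ei eo = contradiction (trans (sym (pairs-none G {X} {not ∘ X} λ u v _ x → contradiction x (empty {not ∘ X} eo v))) pairs≡3) λ ()
    cases (suc (suc i)) 1 ei eo = inj₂ eo
    cases (suc (suc i)) (suc (suc o)) ei eo = contradiction
      (X , cut , subst (2 ≤_) (sym ei) (s≤s (s≤s z≤n)) , subst (2 ≤_) (sym eo) (s≤s (s≤s z≤n))) none

record Side {n m₁ m₂} (s : Split n m₁ m₂) (G : Graph n) : Set where
  field
    simple : IsSimple (contract s G)
    cubic  : Cubic (contract s G)
    colour : Fin (suc m₁) → Bool
    proper : ProperColouring (contract s G) colour
    rows   : ∀ a → count (λ b → G (e₁ s a) (e₂ s b)) ≤ 1

side-of-cut : ∀ {n m₁ m₂} (s : Split n m₁ m₂) {G : Graph n} {c} → IsSimple G → Cubic G → ProperColouring G c →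
              TwoFactorsConnected G → 2 ≤ m₁ → crossing s G ≡ 3 → Side s G
side-of-cut s {G} {c} simple cub col 2fc big total = record
  { simple = contract-simple s G simple
  ; cubic  = contract-cubic s G rows cub total
  ; proper = contract-proper s G (proj₁ κ) col (proj₂ κ)
  ; rows   = rows
  }
  where
  rows = crossing⇒rows s (proj₁ simple) cub col 2fc big total
  κ = cross-colour s (proj₁ simple) cub col total

Hypotheses : ∀ {n} → Graph n → Set
Hypotheses G = IsSimple G × Cubic G × Bipartite G × TwoFactorHamiltonian G

contract-hypotheses : ∀ {n m₁ m₂} (s : Split n m₁ m₂) {G : Graph n} → Symmetric G → TwoFactorsConnected G →
                      Side s G → Side (swap s) G → crossing s G ≡ 3 → 2 ≤ m₁ → Hypotheses (contract s G)
contract-hypotheses s {G} sy 2fc S S′ total 2≤m₁ =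
  S.simple , S.cubic , (S.colour , S.proper) ,
  -- Two vertices of the shore and the contracted one make the three that a cycle needs.
  2fc⇒tfh (s≤s 2≤m₁) S.proper
    (contract-connected s sy S.rows S′.rows total (proj₁ S′.simple) S′.cubic
      (three-factors (contract (swap s) G) (proj₁ S′.simple) S′.cubic S′.proper) 2fc)
  where
  module S = Side S
  module S′ = Side S′

module _ {n : ℕ} {G : Graph n} (hyp : Hypotheses G)
         (ih : ∀ {m} → m < n → (H : Graph m) → Hypotheses H → ConstructibleUpTo≅ H) where

  cut⇒constructible : ∃[ X ] NontrivialThreeCut G X → ConstructibleUpTo≅ G
  cut⇒constructible (X , cut , in≥2 , out≥2) = from-split (partition X)
    where
    simple = proj₁ hyp
    sy = proj₁ simple
    cub = proj₁ (proj₂ hyp)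
    col = proj₂ (proj₁ (proj₂ (proj₂ hyp)))

    2fc : TwoFactorsConnected G
    2fc = tfh⇒2fc (proj₂ (proj₂ (proj₂ hyp)))

    -- At least two vertices are replaced by one.
    smaller : ∀ {k₁ k₂} → Split n k₁ k₂ → 2 ≤ k₂ → suc k₁ < n
    smaller {k₁} {k₂} s 2≤k₂ = subst (2 + k₁ ≤_)
      (trans (+-comm k₂ k₁) (sym (Perm.↔⇒≡ (↔-sym +↔⊎ ↔-∘ s)))) (+-monoˡ-≤ k₁ 2≤k₂)

    from-split : (∃[ m₁ ] ∃[ m₂ ] Σ (Split n m₁ m₂) λ s → (∀ a → X (e₁ s a) ≡ true) × (∀ b → X (e₂ s b) ≡ false)) →
                 ConstructibleUpTo≅ G
    from-split (m₁ , m₂ , s , X-e₁ , X-e₂) = glue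
      (ih (smaller s 2≤m₂) (contract s G) (contract-hypotheses s sy 2fc S₁ S₂ total 2≤m₁))
      (ih (smaller (swap s) 2≤m₁) (contract (swap s) G) (contract-hypotheses (swap s) sy 2fc S₂
        -- The double swap has the same embeddings as `s` by computation, so `total` applies to it
        -- directly.
        (side-of-cut (swap (swap s)) simple cub col 2fc 2≤m₁ total) total′ 2≤m₂))
      where
      2≤m₁ : 2 ≤ m₁
      2≤m₁ = subst (2 ≤_) (count-inside s X-e₁ X-e₂) in≥2
      2≤m₂ : 2 ≤ m₂
      2≤m₂ = subst (2 ≤_) (count-outside s X-e₁ X-e₂) out≥2

      total : crossing s G ≡ 3
      total = trans (sym (cut≡crossing s X-e₁ X-e₂ G)) cut
      total′ : crossing (swap s) G ≡ 3
      total′ = trans (crossing-swap s sy) total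

      S₁ : Side s G
      S₁ = side-of-cut s simple cub col 2fc 2≤m₁ total
      S₂ : Side (swap s) G
      S₂ = side-of-cut (swap s) simple cub col 2fc 2≤m₂ total′

      glue : ConstructibleUpTo≅ (contract s G) → ConstructibleUpTo≅ (contract (swap s) G) → ConstructibleUpTo≅ G
      glue (H₁ , con₁ , iso₁) (H₂ , con₂ , iso₂) =
        Reassemble.constructible s sy (Side.rows S₁) (Side.rows S₂) (Side.cubic S₁) (Side.cubic S₂) con₁ con₂ iso₁ iso₂

brace⇒constructible : ∀ {n} {G : Graph n} → Hypotheses G → Statement2 →
                      ¬ (∃[ X ] NontrivialThreeCut G X) → ConstructibleUpTo≅ G
brace⇒constructible {n} {G} (simple@(sy , _) , cub , (c , col) , tfh) st2 none =
  known (st2 n G simple cub (no-three-cut⇒brace simple cub col (three-factors G sy cub col) (tfh⇒2fc tfh) none) tfh)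
  where
  known : (G ≅ K33) ⊎ (G ≅ Heawood) → ConstructibleUpTo≅ G
  -- The isomorphism forces `n` to be 6, respectively 14 in the next case.
  known (inj₁ iso@(f , _)) with refl ← Perm.↔⇒≡ (⤖⇒↔ f) = K33 , k33 , iso
  known (inj₂ iso@(f , _)) with refl ← Perm.↔⇒≡ (⤖⇒↔ f) = Heawood , heawood , iso

2⇒1 : Statement2 → Statement1
2⇒1 st2 n G simple cub bip tfh = go (<-wellFounded n) G (simple , cub , bip , tfh)
  where
  decide : ∀ {n} {G : Graph n} → Hypotheses G →
           (∀ {m} → m < n → (H : Graph m) → Hypotheses H → ConstructibleUpTo≅ H) →
           Dec (∃[ X ] NontrivialThreeCut G X) → ConstructibleUpTo≅ G
  decide hyp ih (yes cut) = cut⇒constructible hyp ih cut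
  decide hyp ih (no none) = brace⇒constructible hyp st2 none

  go : ∀ {n} → Acc _<_ n → (G : Graph n) → Hypotheses G → ConstructibleUpTo≅ G
  go (acc rec) G hyp = decide hyp (λ lt → go (rec lt)) (nontrivialThreeCut? G)

theorem2p8 : Statement1 ⇔ Statement2
theorem2p8 = mk⇔ 1⇒2 2⇒1
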